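{- Let $q$ be a prime power and $m,n$ positive integers. For every primitive polynomial $f(X)\in\mathbb{F}_q[X]$ of degree $mn$, there exists an $(m,n)$-block companion matrix $T$ over $\mathbb{F}_q$ such that $T\in\mathrm{GL}_{mn}(\mathbb{F}_q)$, the order of $T$ in $\mathrm{GL}_{mn}(\mathbb{F}_q)$ is $q^{mn}-1$, and $\det(XI_{mn}-T)=f(X)$. In other words, the map sending a matrix $T\in\mathrm{BCM}(m,n;q)\cap\mathrm{GL}_{mn}(\mathbb{F}_q)$ of order $q^{mn}-1$ to its characteristic polynomial is a surjection onto the set of primitive polynomials of degree $mn$ in $\mathbb{F}_q[X]$.
   Context: A monic polynomial $f(X)\in\mathbb{F}_q[X]$ of degree $d$ is primitive if $f(0)\neq 0$ and the least positive integer $e$ with $f(X)\mid X^e-1$ equals $q^d-1$. An $(m,n)$-block companion matrix over $\mathbb{F}_q$ is an $mn\times mn$ matrix of the block form whose $n\times n$ array of $m\times m$ blocks has the identity $I_m$ in block positions $(k+1,k)$ for $k=1,\dots,n-1$, arbitrary blocks $C_0,C_1,\dots,C_{n-1}\in M_m(\mathbb{F}_q)$ down the last block column (block $(k,n)$ equal to $C_{k-1}$), and zero blocks elsewhere; $\mathrm{BCM}(m,n;q)$ denotes the set of all such matrices. -}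

module Defs where

open import Level using (Level; _⊔_)
open import Data.Nat as ℕ using (ℕ; zero; suc; _^_; _∸_; _≤_; _<_)
open import Data.Nat.Primality using (Prime)
open import Data.Fin as Fin using (Fin; toℕ; punchIn; remQuot)
open import Data.List using (List; []; _∷_; map; replicate; _++_)
open import Data.Product using (Σ; ∃; _×_; _,_)
open import Relation.Nullary using (¬_; does)
open import Relation.Binary.PropositionalEquality using (_≡_)
open import Relation.Binary.Bundles using (Setoid)
import Relation.Binary.PropositionalEquality as Eq
open import Function.Bundles using (Inverse)
open import Algebra.Bundles using (CommutativeRing)
open import Data.Bool using (if_then_else_)

IsPrimePower : ℕ → Set
IsPrimePower q = Σ ℕ λ p → Σ ℕ λ k → Prime p × 1 ≤ k × q ≡ p ^ k

module Det {a} {A : Set a} (_+_ _*_ : A → A → A) (-_ : A → A) (0# 1# : A) where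

  sumFin : ∀ n → (Fin n → A) → A
  sumFin zero    f = 0#
  sumFin (suc n) f = f Fin.zero + sumFin n (λ i → f (Fin.suc i))

  signed : ℕ → A → A
  signed zero    x = x
  signed (suc k) x = - (signed k x)

  det : ∀ n → (Fin n → Fin n → A) → A
  det zero    M = 1#
  det (suc n) M = sumFin (suc n) λ j →
    signed (toℕ j) (M Fin.zero j * det n (λ r s → M (Fin.suc r) (punchIn j s)))

module Over {c ℓ} (R : CommutativeRing c ℓ) where
  open CommutativeRing R

  IsField : Set (c ⊔ ℓ)
  IsField = (¬ (1# ≈ 0#)) × (∀ x → ¬ (x ≈ 0#) → Σ Carrier λ y → (x * y) ≈ 1#)

  IsFiniteField : ℕ → Set (c ⊔ ℓ)
  IsFiniteField q = IsField × Inverse setoid (Eq.setoid (Fin q))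

  -- Polynomials R[X] as coefficient lists (constant term first);
  -- two lists denote the same polynomial iff all coefficients agree.

  Poly : Set c
  Poly = List Carrier

  coeff : Poly → ℕ → Carrier
  coeff []       _       = 0#
  coeff (a ∷ p)  zero    = a
  coeff (a ∷ p)  (suc k) = coeff p k

  infix 4 _≈ₚ_
  _≈ₚ_ : Poly → Poly → Set ℓ
  p ≈ₚ r = ∀ k → coeff p k ≈ coeff r k

  _+ₚ_ : Poly → Poly → Poly
  []      +ₚ r       = r
  (a ∷ p) +ₚ []      = a ∷ p
  (a ∷ p) +ₚ (b ∷ r) = (a + b) ∷ (p +ₚ r)

  -ₚ_ : Poly → Poly
  -ₚ p = map -_ p

  _*ₚ_ : Poly → Poly → Poly
  []      *ₚ r = []
  (a ∷ p) *ₚ r = map (a *_) r +ₚ (0# ∷ (p *ₚ r))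

  constₚ : Carrier → Poly
  constₚ x = x ∷ []

  Xpow : ℕ → Poly
  Xpow e = replicate e 0# ++ (1# ∷ [])

  Xₚ : Poly
  Xₚ = Xpow 1

  _∣ₚ_ : Poly → Poly → Set (c ⊔ ℓ)
  f ∣ₚ g = Σ Poly λ h → (f *ₚ h) ≈ₚ g

  MonicOfDegree : ℕ → Poly → Set ℓ
  MonicOfDegree d f = (coeff f d ≈ 1#) × (∀ k → d < k → coeff f k ≈ 0#)

  Primitive : (q d : ℕ) → Poly → Set (c ⊔ ℓ)
  Primitive q d f =
    MonicOfDegree d f × ¬ (coeff f 0 ≈ 0#) ×
    (f ∣ₚ (Xpow (q ^ d ∸ 1) +ₚ constₚ (- 1#))) ×
    (∀ e → 1 ≤ e → e < q ^ d ∸ 1 → ¬ (f ∣ₚ (Xpow e +ₚ constₚ (- 1#))))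

  Mat : ℕ → Set c
  Mat N = Fin N → Fin N → Carrier

  infix 4 _≈ₘ_
  _≈ₘ_ : ∀ {N} → Mat N → Mat N → Set ℓ
  A ≈ₘ B = ∀ i j → A i j ≈ B i j

  δ : ∀ {N} → Fin N → Fin N → Carrier
  δ i j = if does (i Fin.≟ j) then 1# else 0#

  Iₘ : ∀ {N} → Mat N
  Iₘ = δ

  open Det _+_ _*_ -_ 0# 1# using (sumFin; det) public

  _*ₘ_ : ∀ {N} → Mat N → Mat N → Mat N
  _*ₘ_ {N} A B i j = sumFin N λ k → A i k * B k j

  _^ₘ_ : ∀ {N} → Mat N → ℕ → Mat N
  A ^ₘ zero  = Iₘ
  A ^ₘ suc e = A *ₘ (A ^ₘ e)

  Invertible : ∀ {N} → Mat N → Set (c ⊔ ℓ)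
  Invertible {N} T = Σ (Mat N) λ S → ((T *ₘ S) ≈ₘ Iₘ) × ((S *ₘ T) ≈ₘ Iₘ)

  HasOrder : ∀ {N} → Mat N → ℕ → Set ℓ
  HasOrder T k = 1 ≤ k × ((T ^ₘ k) ≈ₘ Iₘ) × (∀ e → 1 ≤ e → e < k → ¬ ((T ^ₘ e) ≈ₘ Iₘ))

  charPoly : ∀ {N} → Mat N → Poly
  charPoly {N} T =
    Det.det _+ₚ_ _*ₚ_ -ₚ_ [] (constₚ 1#) N
      (λ i j → (if does (i Fin.≟ j) then Xₚ else []) +ₚ constₚ (- (T i j)))

  -- (m,n)-block companion matrices, of size (n * m) × (n * m).
  -- Row index combine i a (block row i : Fin n, inner row a : Fin m),
  -- i.e. global index i * m + a.  Block (k+1,k) is I_m for k < n-1,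
  -- block (i, n-1) of the last block column is C i, all other blocks 0.

  bcm : (m n : ℕ) → (Fin n → Mat m) → Mat (n ℕ.* m)
  bcm m n C I J with remQuot {n} m I | remQuot {n} m J
  ... | (i , a) | (j , b) =
    if does (suc (toℕ j) ℕ.≟ n) then C i a b
    else (if does (toℕ i ℕ.≟ suc (toℕ j)) then δ a b else 0#)

{-# OPTIONS --safe #-}
module Submission where

-- Let α be the class of X in F[X]/(f).  Multiplication by α, written in the basis
-- α^{i + n b} (0 ≤ i < n, 0 ≤ b < m) with i as the block index, is a block companion
-- matrix: it shifts i to i + 1 inside a block column.  So the companion matrix of f,
-- conjugated by the permutation that transposes the n × m grid of exponents, is the
-- required T.  Its e-th power is I iff f divides X^e − 1, which gives the order, and
-- the characteristic polynomial is unchanged by conjugation.  The determinant is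
-- Laplace expansion along the first row, so its invariance under conjugation is
-- obtained from adjacent swaps of rows and of columns, each of which flips the sign.

open import Defs
open import Algebra.Bundles using (CommutativeRing; CommutativeMonoid)
open import Algebra.Morphism.Structures using (module RingMorphisms)
open import Algebra.Structures using (IsCommutativeRing)
open import Data.Bool using (true; false; _∧_; if_then_else_)
open import Data.Nat as ℕ using (ℕ; zero; suc; _*_; _^_; _∸_; _≤_; _<_; s≤s; z≤n; nonTrivial⇒n>1)
import Data.Nat.Properties as ℕ
open import Data.Nat.Primality using (prime⇒nonTrivial)
open import Data.Fin as Fin
  using (Fin; zero; suc; toℕ; fromℕ; fromℕ<; cast; opposite; punchIn; punchOut; combine; remQuot)
open import Data.Fin.Properties
  using (suc-injective; punchOut-injective; punchIn-punchOut; toℕ-injective; toℕ<n; toℕ-cast;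
         toℕ-fromℕ; toℕ-fromℕ<; toℕ-combine; combine-injective; combine-remQuot; remQuot-combine;
         opposite-prop; *↔×)
open import Data.Fin.Permutation
  using (Permutation; _⟨$⟩ʳ_; _⟨$⟩ˡ_; inverseʳ; cast-id; reverse)
open import Data.List using (List; []; _∷_; map; _++_)
open import Data.Product using (Σ; _×_; _,_; proj₁; proj₂)
open import Data.Product.Algebra using (×-comm)
open import Function.Bundles using (_⇔_; mk⇔; Equivalence; Injection)
open import Function.Construct.Composition using (_↔-∘_)
open import Function.Construct.Symmetry using (↔-sym)
open import Function.Properties.Inverse using (↔⇒↣)
open import Relation.Binary using (Tri; tri<; tri≈; tri>)
open import Relation.Nullary using (¬_; Dec; does; yes; no; contradiction)
open import Relation.Nullary.Decidable using (does-⇔; _×-dec_)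
import Relation.Binary.PropositionalEquality as ≡
open ≡ using (_≡_)
import Relation.Binary.Reasoning.Setoid as SetoidReasoning
import Algebra.Properties.Ring as RingProperties
import Algebra.Properties.CommutativeSemigroup as CommutativeSemigroupProperties

open RingMorphisms using (IsRingHomomorphism)

-- Multiplication by α raises the block index i by one as long as i < n - 1. From i = n - 1 it leads
-- to exponent n (b + 1), which lies in the first block again or, for the last b, has to be reduced
-- modulo f. Both cases belong to the last block column, where a block companion matrix is
-- unrestricted, so those blocks are read off and never computed. The quotient ring is not formed. A
-- congruence modulo f is an equation with an explicit multiple of f, and a multiple of degree below
-- that of f is shown to vanish by comparing coefficients. The identities themselves are proved in
-- an arbitrary commutative ring with a homomorphism from the scalars and an element x; coefficient
-- lists are opened only for the statements about degrees. Invariance of the determinant is needed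
-- only for conjugation by a permutation. Rows and columns then move by the same word in adjacent
-- transpositions, so the signs cancel in pairs: neither the sign of a permutation nor
-- multiplicativity of the determinant has to be developed.

module PolynomialRing {c ℓ} (R : CommutativeRing c ℓ) where
  open CommutativeRing R hiding (zero) renaming (_*_ to _·_)
  open Over R
  open RingProperties ring using (-0#≈0#)
  open CommutativeSemigroupProperties
    (CommutativeMonoid.commutativeSemigroup +-commutativeMonoid) using (interchange)
  open SetoidReasoning setoid

  -- The polynomial ring, by way of convolution of coefficient sequences.

  conv : (ℕ → Carrier) → (ℕ → Carrier) → ℕ → Carrier
  conv f g zero    = f 0 · g 0
  conv f g (suc k) = f 0 · g (suc k) + conv (λ i → f (suc i)) g k

  conv-cong : ∀ {f f′ g g′} → (∀ k → f k ≈ f′ k) → (∀ k → g k ≈ g′ k) →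
              ∀ k → conv f g k ≈ conv f′ g′ k
  conv-cong p q zero    = *-cong (p 0) (q 0)
  conv-cong p q (suc k) =
    +-cong (*-cong (p 0) (q (suc k))) (conv-cong (λ i → p (suc i)) q k)

  conv-zeroˡ : ∀ g k → conv (λ _ → 0#) g k ≈ 0#
  conv-zeroˡ g zero    = zeroˡ _
  conv-zeroˡ g (suc k) = trans (+-cong (zeroˡ _) (conv-zeroˡ g k)) (+-identityˡ 0#)

  conv-distribʳ : ∀ f f′ g k →
                  conv (λ i → f i + f′ i) g k ≈ conv f g k + conv f′ g k
  conv-distribʳ f f′ g zero    = distribʳ _ _ _
  conv-distribʳ f f′ g (suc k) =
    trans (+-cong (distribʳ _ _ _) (conv-distribʳ _ _ g k)) (interchange _ _ _ _)

  conv-scaleˡ : ∀ a f g k → conv (λ i → a · f i) g k ≈ a · conv f g k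
  conv-scaleˡ a f g zero    = *-assoc _ _ _
  conv-scaleˡ a f g (suc k) =
    trans (+-cong (*-assoc _ _ _) (conv-scaleˡ a _ g k)) (sym (distribˡ _ _ _))

  -- `conv` splits off the term with `f 0`. Splitting off the opposite end, the term with `g 0`, is
  -- what lets commutativity go through by induction.
  conv-unfoldʳ : ∀ f g k →
                 conv f g (suc k) ≈ conv f (λ i → g (suc i)) k + f (suc k) · g 0
  conv-unfoldʳ f g zero    = refl
  conv-unfoldʳ f g (suc k) =
    trans (+-congˡ (conv-unfoldʳ (λ i → f (suc i)) g k)) (sym (+-assoc _ _ _))

  conv-comm : ∀ f g k → conv f g k ≈ conv g f k
  conv-comm f g zero    = *-comm _ _
  conv-comm f g (suc k) = begin
    f 0 · g (suc k) + conv (λ i → f (suc i)) g k  ≈⟨ +-comm _ _ ⟩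
    conv (λ i → f (suc i)) g k + f 0 · g (suc k)  ≈⟨ +-cong (conv-comm _ g k) (*-comm _ _) ⟩
    conv g (λ i → f (suc i)) k + g (suc k) · f 0  ≈⟨ conv-unfoldʳ g f k ⟨
    conv g f (suc k)                              ∎

  -- The shift of `conv f g` is `f 0` times the shift of `g` plus `conv f⁺ g`, so linearity in the
  -- left factor reduces the claim to the induction hypothesis for `f⁺`.
  conv-assoc : ∀ f g h k → conv (conv f g) h k ≈ conv f (conv g h) k
  conv-assoc f g h zero    = *-assoc _ _ _
  conv-assoc f g h (suc k) = begin
    (f 0 · g 0) · h (suc k) + conv (λ i → f 0 · g (suc i) + conv f⁺ g i) h k
      ≈⟨ +-cong (*-assoc _ _ _) (conv-distribʳ _ _ h k) ⟩
    f 0 · (g 0 · h (suc k)) + (conv (λ i → f 0 · g (suc i)) h k + conv (conv f⁺ g) h k)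
      ≈⟨ +-assoc _ _ _ ⟨
    f 0 · (g 0 · h (suc k)) + conv (λ i → f 0 · g (suc i)) h k + conv (conv f⁺ g) h k
      ≈⟨ +-cong (+-congˡ (conv-scaleˡ (f 0) _ h k)) (conv-assoc f⁺ g h k) ⟩
    f 0 · (g 0 · h (suc k)) + f 0 · conv (λ i → g (suc i)) h k + conv f⁺ (conv g h) k
      ≈⟨ +-congʳ (distribˡ _ _ _) ⟨
    f 0 · conv g h (suc k) + conv f⁺ (conv g h) k ∎
    where f⁺ = λ i → f (suc i)

  coeff-+ : ∀ p r k → coeff (p +ₚ r) k ≈ coeff p k + coeff r k
  coeff-+ []      r       k       = sym (+-identityˡ _)
  coeff-+ (a ∷ p) []      k       = sym (+-identityʳ _)
  coeff-+ (a ∷ p) (b ∷ r) zero    = refl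
  coeff-+ (a ∷ p) (b ∷ r) (suc k) = coeff-+ p r k

  coeff-neg : ∀ p k → coeff (-ₚ p) k ≈ - coeff p k
  coeff-neg []      k       = sym -0#≈0#
  coeff-neg (a ∷ p) zero    = refl
  coeff-neg (a ∷ p) (suc k) = coeff-neg p k

  coeff-scale : ∀ a p k → coeff (map (a ·_) p) k ≈ a · coeff p k
  coeff-scale a []      k       = sym (zeroʳ a)
  coeff-scale a (b ∷ p) zero    = refl
  coeff-scale a (b ∷ p) (suc k) = coeff-scale a p k

  -- Lists of different lengths may denote the same polynomial. Passing to coefficient sequences
  -- removes the lengths from the proofs of the ring laws.
  coeff-* : ∀ p r k → coeff (p *ₚ r) k ≈ conv (coeff p) (coeff r) k
  coeff-* []      r k       = sym (conv-zeroˡ (coeff r) k)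
  coeff-* (a ∷ p) r zero    =
    trans (coeff-+ (map (a ·_) r) _ 0) (trans (+-identityʳ _) (coeff-scale a r 0))
  coeff-* (a ∷ p) r (suc k) =
    trans (coeff-+ (map (a ·_) r) _ (suc k)) (+-cong (coeff-scale a r (suc k)) (coeff-* p r k))

  coeff-const-* : ∀ a p k → coeff (constₚ a *ₚ p) k ≈ a · coeff p k
  coeff-const-* a p zero    = coeff-* (constₚ a) p 0
  coeff-const-* a p (suc k) =
    trans (coeff-* (constₚ a) p (suc k)) (trans (+-congˡ (conv-zeroˡ _ k)) (+-identityʳ _))

  +ₚ-cong : ∀ {p p′ r r′} → p ≈ₚ p′ → r ≈ₚ r′ → (p +ₚ r) ≈ₚ (p′ +ₚ r′)
  +ₚ-cong {p} {p′} {r} {r′} p≈ r≈ k =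
    trans (coeff-+ p r k) (trans (+-cong (p≈ k) (r≈ k)) (sym (coeff-+ p′ r′ k)))

  *ₚ-cong : ∀ {p p′ r r′} → p ≈ₚ p′ → r ≈ₚ r′ → (p *ₚ r) ≈ₚ (p′ *ₚ r′)
  *ₚ-cong {p} {p′} {r} {r′} p≈ r≈ k =
    trans (coeff-* p r k) (trans (conv-cong p≈ r≈ k) (sym (coeff-* p′ r′ k)))

  *ₚ-comm : ∀ p r → (p *ₚ r) ≈ₚ (r *ₚ p)
  *ₚ-comm p r k =
    trans (coeff-* p r k) (trans (conv-comm _ _ k) (sym (coeff-* r p k)))

  *ₚ-assoc : ∀ p r s → ((p *ₚ r) *ₚ s) ≈ₚ (p *ₚ (r *ₚ s))
  *ₚ-assoc p r s k = begin
    coeff ((p *ₚ r) *ₚ s) k                      ≈⟨ coeff-* (p *ₚ r) s k ⟩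
    conv (coeff (p *ₚ r)) (coeff s) k            ≈⟨ conv-cong (coeff-* p r) (λ _ → refl) k ⟩
    conv (conv (coeff p) (coeff r)) (coeff s) k  ≈⟨ conv-assoc _ _ _ k ⟩
    conv (coeff p) (conv (coeff r) (coeff s)) k  ≈⟨ conv-cong (λ _ → refl) (coeff-* r s) k ⟨
    conv (coeff p) (coeff (r *ₚ s)) k            ≈⟨ coeff-* p (r *ₚ s) k ⟨
    coeff (p *ₚ (r *ₚ s)) k                      ∎

  *ₚ-identityˡ : ∀ p → (constₚ 1# *ₚ p) ≈ₚ p
  *ₚ-identityˡ p k = trans (coeff-const-* 1# p k) (*-identityˡ _)

  *ₚ-distribʳ : ∀ p r s → ((r +ₚ s) *ₚ p) ≈ₚ ((r *ₚ p) +ₚ (s *ₚ p))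
  *ₚ-distribʳ p r s k = begin
    coeff ((r +ₚ s) *ₚ p) k                                  ≈⟨ coeff-* (r +ₚ s) p k ⟩
    conv (coeff (r +ₚ s)) (coeff p) k                        ≈⟨ conv-cong (coeff-+ r s) (λ _ → refl) k ⟩
    conv (λ i → coeff r i + coeff s i) (coeff p) k           ≈⟨ conv-distribʳ _ _ _ k ⟩
    conv (coeff r) (coeff p) k + conv (coeff s) (coeff p) k  ≈⟨ +-cong (coeff-* r p k) (coeff-* s p k) ⟨
    coeff (r *ₚ p) k + coeff (s *ₚ p) k                      ≈⟨ coeff-+ (r *ₚ p) _ k ⟨
    coeff ((r *ₚ p) +ₚ (s *ₚ p)) k                           ∎

  isCommutativeRingₚ : IsCommutativeRing _≈ₚ_ _+ₚ_ _*ₚ_ -ₚ_ [] (constₚ 1#)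
  isCommutativeRingₚ = record
    { isRing = record
      { +-isAbelianGroup = record
        { isGroup = record
          { isMonoid = record
            { isSemigroup = record
              { isMagma = record
                { isEquivalence = record
                  { refl  = λ _ → refl
                  ; sym   = λ p k → sym (p k)
                  ; trans = λ p r k → trans (p k) (r k)
                  }
                ; ∙-cong = λ {p} {p′} {r} {r′} → +ₚ-cong {p} {p′} {r} {r′}
                }
              ; assoc = λ p r s k →
                  trans (coeff-+ (p +ₚ r) s k)
                 (trans (+-congʳ (coeff-+ p r k))
                 (trans (+-assoc _ _ _)
                 (trans (+-congˡ (sym (coeff-+ r s k))) (sym (coeff-+ p (r +ₚ s) k)))))
              }
            ; identity = (λ _ _ → refl) , (λ p k → trans (coeff-+ p [] k) (+-identityʳ _))
            }
          ; inverse =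
              (λ p k → trans (coeff-+ (-ₚ p) p k) (trans (+-congʳ (coeff-neg p k)) (-‿inverseˡ _))) ,
              (λ p k → trans (coeff-+ p (-ₚ p) k) (trans (+-congˡ (coeff-neg p k)) (-‿inverseʳ _)))
          ; ⁻¹-cong = λ {p} {r} p≈r k →
              trans (coeff-neg p k) (trans (-‿cong (p≈r k)) (sym (coeff-neg r k)))
          }
        ; comm = λ p r k →
            trans (coeff-+ p r k) (trans (+-comm _ _) (sym (coeff-+ r p k)))
        }
      ; *-cong     = λ {p} {p′} {r} {r′} → *ₚ-cong {p} {p′} {r} {r′}
      ; *-assoc    = *ₚ-assoc
      ; *-identity = *ₚ-identityˡ ,
          (λ p k → trans (*ₚ-comm p (constₚ 1#) k) (*ₚ-identityˡ p k))
      ; distrib    =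
          (λ p r s k →
            trans (*ₚ-comm p (r +ₚ s) k)
           (trans (*ₚ-distribʳ p r s k)
                  (+ₚ-cong {r *ₚ p} {p *ₚ r} {s *ₚ p} {p *ₚ s} (*ₚ-comm r p) (*ₚ-comm s p) k))) ,
          *ₚ-distribʳ
      }
    ; *-comm = *ₚ-comm
    }

  polynomialRing : CommutativeRing c ℓ
  polynomialRing = record { isCommutativeRing = isCommutativeRingₚ }

-- Adjacent transpositions and words in them.

adjacentSwap : ∀ {n} → Fin n → Fin (suc n) → Fin (suc n)
adjacentSwap zero    zero          = suc zero
adjacentSwap zero    (suc zero)    = zero
adjacentSwap zero    (suc (suc j)) = suc (suc j)
adjacentSwap (suc i) zero          = zero
adjacentSwap (suc i) (suc j)       = suc (adjacentSwap i j)

-- What a swap does to the columns left after deleting column `j`. If `j` is not swapped, an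
-- adjacent swap remains among the others. If it is, the others keep their order and only the
-- deleted column moves, by one place.
data PunchInSwap {n} (i : Fin (suc n)) (j : Fin (suc (suc n))) : Set where
  fixed : ∀ i′ → adjacentSwap i j ≡ j →
          (∀ s → adjacentSwap i (punchIn j s) ≡ punchIn j (adjacentSwap i′ s)) →
          PunchInSwap i j
  up    : toℕ (adjacentSwap i j) ≡ suc (toℕ j) →
          (∀ s → adjacentSwap i (punchIn j s) ≡ punchIn (adjacentSwap i j) s) →
          PunchInSwap i j
  down  : toℕ j ≡ suc (toℕ (adjacentSwap i j)) →
          (∀ s → adjacentSwap i (punchIn j s) ≡ punchIn (adjacentSwap i j) s) →
          PunchInSwap i j

punchInSwap : ∀ {n} (i : Fin (suc n)) j → PunchInSwap i j
punchInSwap zero zero = up ≡.refl λ { zero → ≡.refl ; (suc _) → ≡.refl }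
punchInSwap zero (suc zero) = down ≡.refl λ { zero → ≡.refl ; (suc _) → ≡.refl }
punchInSwap {suc n} zero (suc (suc j)) =
  fixed zero ≡.refl λ { zero → ≡.refl ; (suc zero) → ≡.refl ; (suc (suc _)) → ≡.refl }
punchInSwap {suc n} (suc i) zero = fixed i ≡.refl λ _ → ≡.refl
punchInSwap {suc n} (suc i) (suc j) with punchInSwap i j
... | fixed i′ eq h = fixed (suc i′) (≡.cong suc eq) λ { zero → ≡.refl ; (suc s) → ≡.cong suc (h s) }
... | up eq h   = up (≡.cong suc eq) λ { zero → ≡.refl ; (suc s) → ≡.cong suc (h s) }
... | down eq h = down (≡.cong suc eq) λ { zero → ≡.refl ; (suc s) → ≡.cong suc (h s) }

act : ∀ {n} → List (Fin n) → Fin (suc n) → Fin (suc n)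
act []      j = j
act (i ∷ w) j = adjacentSwap i (act w j)

act-++ : ∀ {n} (v w : List (Fin n)) j → act (v ++ w) j ≡ act v (act w j)
act-++ []      w j = ≡.refl
act-++ (i ∷ v) w j = ≡.cong (adjacentSwap i) (act-++ v w j)

act-map-suc-zero : ∀ {n} (w : List (Fin n)) → act (map suc w) zero ≡ zero
act-map-suc-zero []      = ≡.refl
act-map-suc-zero (i ∷ w) = ≡.cong (adjacentSwap (suc i)) (act-map-suc-zero w)

act-map-suc-suc : ∀ {n} (w : List (Fin n)) j → act (map suc w) (suc j) ≡ suc (act w j)
act-map-suc-suc []      j = ≡.refl
act-map-suc-suc (i ∷ w) j = ≡.cong (adjacentSwap (suc i)) (act-map-suc-suc w j)

-- The cycle that carries 0 to `k` and preserves the order of all other elements.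
rotation : ∀ {n} → Fin (suc n) → List (Fin n)
rotation         zero    = []
rotation {suc n} (suc k) = map suc (rotation k) ++ zero ∷ []

act-rotation-zero : ∀ {n} (k : Fin (suc n)) → act (rotation k) zero ≡ k
act-rotation-zero         zero    = ≡.refl
act-rotation-zero {suc n} (suc k) =
  ≡.trans (act-++ (map suc (rotation k)) _ zero)
 (≡.trans (act-map-suc-suc (rotation k) zero) (≡.cong suc (act-rotation-zero k)))

act-rotation-suc : ∀ {n} (k : Fin (suc n)) j → act (rotation k) (suc j) ≡ punchIn k j
act-rotation-suc         zero    j       = ≡.refl
act-rotation-suc {suc n} (suc k) zero    =
  ≡.trans (act-++ (map suc (rotation k)) _ (suc zero)) (act-map-suc-zero (rotation k))
act-rotation-suc {suc n} (suc k) (suc j) =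
  ≡.trans (act-++ (map suc (rotation k)) _ (suc (suc j)))
 (≡.trans (act-map-suc-suc (rotation k) (suc j)) (≡.cong suc (act-rotation-suc k j)))

-- Insertion sort: once the rotation has put 0 at `π zero`, the remaining values avoid that place,
-- and closing the gap with `punchOut` leaves an injection on a smaller set.
injective⇒word : ∀ n (π : Fin (suc n) → Fin (suc n)) → (∀ {i j} → π i ≡ π j → i ≡ j) →
                 Σ (List (Fin n)) λ w → ∀ j → π j ≡ act w j
injective⇒word zero    π inj = [] , λ { zero → Fin1-unique (π zero) }
  where
  Fin1-unique : (k : Fin 1) → k ≡ zero
  Fin1-unique zero = ≡.refl
injective⇒word (suc n) π inj = rotation (π zero) ++ map suc w , spec
  where
  ≢ : ∀ j → ¬ (π zero ≡ π (suc j))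
  ≢ j eq with inj eq
  ... | ()
  π′ : Fin (suc n) → Fin (suc n)
  π′ j = punchOut (≢ j)
  w,p = injective⇒word n π′ λ {i} {j} eq →
    suc-injective (inj (punchOut-injective (≢ i) (≢ j) eq))
  w = proj₁ w,p
  spec : ∀ j → π j ≡ act (rotation (π zero) ++ map suc w) j
  spec zero = ≡.sym
    (≡.trans (act-++ (rotation (π zero)) _ zero)
    (≡.trans (≡.cong (act (rotation (π zero))) (act-map-suc-zero w))
             (act-rotation-zero (π zero))))
  spec (suc j) = ≡.sym
    (≡.trans (act-++ (rotation (π zero)) _ (suc j))
    (≡.trans (≡.cong (act (rotation (π zero))) (act-map-suc-suc w j))
    (≡.trans (act-rotation-suc (π zero) (act w j))
    (≡.trans (≡.cong (punchIn (π zero)) (≡.sym (proj₂ w,p j)))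
             (punchIn-punchOut (≢ j))))))

-- The determinant under swaps of rows and columns.

module Determinant {c ℓ} (S : CommutativeRing c ℓ) where
  open CommutativeRing S hiding (zero) renaming (_*_ to _·_)
  open Det _+_ _·_ -_ 0# 1#
  open RingProperties ring using (-0#≈0#; -‿involutive; -‿+-comm; -‿distribˡ-*; -‿distribʳ-*)
  open CommutativeSemigroupProperties
    (CommutativeMonoid.commutativeSemigroup +-commutativeMonoid) using (interchange)
  open CommutativeSemigroupProperties
    (CommutativeMonoid.commutativeSemigroup *-commutativeMonoid) using (x∙yz≈y∙xz)
  open SetoidReasoning setoid

  sumFin-cong : ∀ n {f g} → (∀ i → f i ≈ g i) → sumFin n f ≈ sumFin n g
  sumFin-cong zero    p = refl
  sumFin-cong (suc n) p = +-cong (p zero) (sumFin-cong n λ i → p (suc i))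

  sumFin-zero : ∀ n {f} → (∀ i → f i ≈ 0#) → sumFin n f ≈ 0#
  sumFin-zero zero    p = refl
  sumFin-zero (suc n) p =
    trans (+-cong (p zero) (sumFin-zero n λ i → p (suc i))) (+-identityˡ 0#)

  sumFin-+ : ∀ n f g → sumFin n (λ i → f i + g i) ≈ sumFin n f + sumFin n g
  sumFin-+ zero    f g = sym (+-identityˡ 0#)
  sumFin-+ (suc n) f g = trans (+-congˡ (sumFin-+ n _ _)) (interchange _ _ _ _)

  sumFin-neg : ∀ n f → sumFin n (λ i → - f i) ≈ - sumFin n f
  sumFin-neg zero    f = sym -0#≈0#
  sumFin-neg (suc n) f = trans (+-congˡ (sumFin-neg n _)) (-‿+-comm _ _)

  *-sumFin : ∀ n a f → a · sumFin n f ≈ sumFin n (λ i → a · f i)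
  *-sumFin zero    a f = zeroʳ a
  *-sumFin (suc n) a f = trans (distribˡ _ _ _) (+-congˡ (*-sumFin n a _))

  sumFin-adjacentSwap : ∀ {n} (i : Fin n) f →
    sumFin (suc n) (λ j → f (adjacentSwap i j)) ≈ sumFin (suc n) f
  sumFin-adjacentSwap zero    f =
    trans (sym (+-assoc _ _ _)) (trans (+-congʳ (+-comm _ _)) (+-assoc _ _ _))
  sumFin-adjacentSwap (suc i) f = +-congˡ (sumFin-adjacentSwap i λ j → f (suc j))

  signed-cong : ∀ k {x y} → x ≈ y → signed k x ≈ signed k y
  signed-cong zero    p = p
  signed-cong (suc k) p = -‿cong (signed-cong k p)

  signed-neg : ∀ k x → signed k (- x) ≈ - signed k x
  signed-neg zero    x = refl
  signed-neg (suc k) x = -‿cong (signed-neg k x)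

  signed-zero : ∀ k → signed k 0# ≈ 0#
  signed-zero zero    = refl
  signed-zero (suc k) = trans (-‿cong (signed-zero k)) -0#≈0#

  signed-+ : ∀ k x y → signed k (x + y) ≈ signed k x + signed k y
  signed-+ zero    x y = refl
  signed-+ (suc k) x y = trans (-‿cong (signed-+ k x y)) (sym (-‿+-comm _ _))

  *-signed : ∀ k a x → a · signed k x ≈ signed k (a · x)
  *-signed zero    a x = refl
  *-signed (suc k) a x = trans (sym (-‿distribʳ-* _ _)) (-‿cong (*-signed k a x))

  det-cong : ∀ n {A B} → (∀ i j → A i j ≈ B i j) → det n A ≈ det n B
  det-cong zero    p = refl
  det-cong (suc n) p = sumFin-cong (suc n) λ j →
    signed-cong (toℕ j) (*-cong (p zero j) (det-cong n λ r s → p (suc r) (punchIn j s)))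

  -- In each term of the expansion, column 0 is either deleted, and then the entry in front
  -- vanishes, or it is still the first column of the minor.
  det-zeroColumn : ∀ n A → (∀ i → A i zero ≈ 0#) → det (suc n) A ≈ 0#
  det-zeroColumn n A p = sumFin-zero (suc n)
    {λ j → signed (toℕ j) (A zero j · det n (λ r s → A (suc r) (punchIn j s)))}
    λ j → trans (signed-cong (toℕ j) (term n A p j)) (signed-zero (toℕ j))
    where
    term : ∀ n (A : Fin (suc n) → Fin (suc n) → Carrier) → (∀ i → A i zero ≈ 0#) → ∀ j →
           A zero j · det n (λ r s → A (suc r) (punchIn j s)) ≈ 0#
    term n       A p zero    = trans (*-congʳ (p zero)) (zeroˡ _)
    term (suc n) A p (suc j) =
      trans (*-congˡ (det-zeroColumn n (λ r s → A (suc r) (punchIn (suc j) s)) λ i → p (suc i)))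
            (zeroʳ _)

  -- The terms are matched along the swap. For a column that stays, the sign comes from its minor by
  -- induction; for one of the two that move, the minor is unchanged and the sign comes from the
  -- parity of the column index.
  det-adjacentSwap-columns : ∀ n (i : Fin n) A →
    det (suc n) (λ r s → A r (adjacentSwap i s)) ≈ - det (suc n) A
  det-adjacentSwap-columns (suc n) i A = begin
    sumFin (suc (suc n)) swapped
      ≈⟨ sumFin-cong (suc (suc n)) {swapped} {λ j → - cofactor (adjacentSwap i j)} term ⟩
    sumFin (suc (suc n)) (λ j → - cofactor (adjacentSwap i j))
      ≈⟨ sumFin-neg (suc (suc n)) (λ j → cofactor (adjacentSwap i j)) ⟩
    - sumFin (suc (suc n)) (λ j → cofactor (adjacentSwap i j))
      ≈⟨ -‿cong (sumFin-adjacentSwap i cofactor) ⟩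
    - sumFin (suc (suc n)) cofactor ∎
    where
    minor swappedMinor cofactor swapped : Fin (suc (suc n)) → Carrier
    minor j = det (suc n) λ r s → A (suc r) (punchIn j s)
    swappedMinor j = det (suc n) λ r s → A (suc r) (adjacentSwap i (punchIn j s))
    cofactor j = signed (toℕ j) (A zero j · minor j)
    swapped j = signed (toℕ j) (A zero (adjacentSwap i j) · swappedMinor j)
    minor-cong : ∀ {j} {e : Fin (suc n) → Fin (suc (suc n))} →
      (∀ s → adjacentSwap i (punchIn j s) ≡ e s) →
      swappedMinor j ≈ det (suc n) λ r s → A (suc r) (e s)
    minor-cong h = det-cong (suc n) λ r s → reflexive (≡.cong (A (suc r)) (h s))
    term : ∀ j → swapped j ≈ - cofactor (adjacentSwap i j)
    term j with punchInSwap i j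
    ... | fixed i′ eq h = begin
      signed (toℕ j) (A zero (adjacentSwap i j) · swappedMinor j)
        ≈⟨ signed-cong (toℕ j) (*-cong (reflexive (≡.cong (A zero) eq)) (trans (minor-cong h)
             (det-adjacentSwap-columns n i′ λ r s → A (suc r) (punchIn j s)))) ⟩
      signed (toℕ j) (A zero j · - minor j)
        ≈⟨ signed-cong (toℕ j) (-‿distribʳ-* (A zero j) (minor j)) ⟨
      signed (toℕ j) (- (A zero j · minor j))
        ≈⟨ signed-neg (toℕ j) (A zero j · minor j) ⟩
      - cofactor j
        ≈⟨ -‿cong (reflexive (≡.cong cofactor eq)) ⟨
      - cofactor (adjacentSwap i j) ∎
    ... | up eq h = begin
      signed (toℕ j) (A zero (adjacentSwap i j) · swappedMinor j)
        ≈⟨ signed-cong (toℕ j) (*-congˡ (minor-cong h)) ⟩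
      signed (toℕ j) (A zero (adjacentSwap i j) · minor (adjacentSwap i j))
        ≈⟨ -‿involutive _ ⟨
      - signed (suc (toℕ j)) (A zero (adjacentSwap i j) · minor (adjacentSwap i j))
        ≈⟨ -‿cong (reflexive (≡.cong
             (λ k → signed k (A zero (adjacentSwap i j) · minor (adjacentSwap i j))) eq)) ⟨
      - cofactor (adjacentSwap i j) ∎
    ... | down eq h = begin
      signed (toℕ j) (A zero (adjacentSwap i j) · swappedMinor j)
        ≈⟨ reflexive (≡.cong (λ k → signed k (A zero (adjacentSwap i j) · swappedMinor j)) eq) ⟩
      - signed (toℕ (adjacentSwap i j)) (A zero (adjacentSwap i j) · swappedMinor j)
        ≈⟨ -‿cong (signed-cong (toℕ (adjacentSwap i j)) (*-congˡ (minor-cong h))) ⟩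
      - cofactor (adjacentSwap i j) ∎

  -- The third argument enumerates the columns other than the first two arguments.
  PairTerm : ℕ → Set c
  PairTerm n = Fin (suc (suc n)) → Fin (suc (suc n)) → (Fin n → Fin (suc (suc n))) → Carrier

  -- Since `k` ranks the second column after `j` has been removed, exactly one of the two orders of
  -- a pair has a rank lowered by one. This makes the sign antisymmetric.
  pairSum : ∀ n → PairTerm n → Carrier
  pairSum n φ = sumFin (suc (suc n)) λ j → signed (toℕ j) (sumFin (suc n) λ k →
    signed (toℕ k) (φ j (punchIn j k) λ s → punchIn j (punchIn k s)))

  -- Enumerations of the same columns may agree pointwise without being equal as functions, so terms
  -- are required to respect pointwise agreement.
  Extensional : ∀ {n} → PairTerm n → Set ℓ
  Extensional φ = ∀ x y {e e′} → (∀ s → e s ≡ e′ s) → φ x y e ≈ φ x y e′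

  -- Pairs with j = 0 or k = 0 are exchanged by the flip; the others form the same
  -- sum one size smaller.
  pairSum-flip : ∀ n (φ : PairTerm n) → Extensional φ →
                 pairSum n (λ x y → φ y x) ≈ - pairSum n φ
  pairSum-flip n φ ext = begin
    pairSum n (λ x y → φ y x)                             ≈⟨ split (λ x y → φ y x) ⟩
    (front (λ x y → φ y x) + - front φ) + rest (λ x y → φ y x)
      ≈⟨ +-cong (+-congʳ (sym (-‿involutive _))) (rest-flip n φ ext) ⟩
    (- - front (λ x y → φ y x) + - front φ) + - rest φ    ≈⟨ +-congʳ (-‿+-comm _ _) ⟩
    - (- front (λ x y → φ y x) + front φ) + - rest φ      ≈⟨ -‿+-comm _ _ ⟩
    - ((- front (λ x y → φ y x) + front φ) + rest φ)      ≈⟨ -‿cong (+-congʳ (+-comm _ _)) ⟩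
    - ((front φ + - front (λ x y → φ y x)) + rest φ)      ≈⟨ -‿cong (split φ) ⟨
    - pairSum n φ                                         ∎
    where
    front : ∀ {n} → PairTerm n → Carrier
    front {n} φ = sumFin (suc n) λ k →
      signed (toℕ k) (φ zero (suc k) λ s → suc (punchIn k s))

    inner : ∀ {n} → PairTerm n → Fin (suc n) → Carrier
    inner {n} φ j = sumFin n λ k → - signed (toℕ k)
      (φ (suc j) (suc (punchIn j k)) λ s → punchIn (suc j) (punchIn (suc k) s))

    rest : ∀ {n} → PairTerm n → Carrier
    rest {n} φ = sumFin (suc n) λ j → - signed (toℕ j) (inner φ j)

    -- A pair with second member 0 carries the sign of `suc j`, one more than the sign of the
    -- flipped pair in `front`; hence the minus.
    split : ∀ {n} (φ : PairTerm n) →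
            pairSum n φ ≈ (front φ + - front (λ x y → φ y x)) + rest φ
    split {n} φ = trans (+-congˡ (begin
      sumFin (suc n) (λ j → - signed (toℕ j) (head j + inner φ j))
        ≈⟨ sumFin-cong (suc n) {λ j → - signed (toℕ j) (head j + inner φ j)}
             (λ j → trans (-‿cong (signed-+ (toℕ j) (head j) (inner φ j))) (sym (-‿+-comm _ _))) ⟩
      sumFin (suc n) (λ j → - signed (toℕ j) (head j) + - signed (toℕ j) (inner φ j))
        ≈⟨ sumFin-+ (suc n) (λ j → - signed (toℕ j) (head j)) (λ j → - signed (toℕ j) (inner φ j)) ⟩
      sumFin (suc n) (λ j → - signed (toℕ j) (head j)) + rest φ
        ≈⟨ +-congʳ (sumFin-neg (suc n) λ j → signed (toℕ j) (head j)) ⟩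
      - front (λ x y → φ y x) + rest φ ∎)) (sym (+-assoc _ _ _))
      where
      head : Fin (suc n) → Carrier
      head j = φ (suc j) zero λ s → suc (punchIn j s)

    rest-flip : ∀ n (φ : PairTerm n) → Extensional φ → rest (λ x y → φ y x) ≈ - rest φ
    rest-flip zero    φ ext = begin
      - 0# + 0#      ≈⟨ +-identityʳ _ ⟩
      - 0#           ≈⟨ -‿cong (trans (+-identityʳ _) -0#≈0#) ⟨
      - (- 0# + 0#)  ∎
    rest-flip (suc n) φ ext = begin
      rest (λ x y → φ y x)         ≈⟨ rest≈ (λ x y → φ y x) (λ x y → ext y x) ⟩
      pairSum n (λ x y → φ⁺ y x)   ≈⟨ pairSum-flip n φ⁺ (λ x y p → ext (suc x) (suc y)
                                        λ { zero → ≡.refl ; (suc s) → ≡.cong suc (p s) }) ⟩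
      - pairSum n φ⁺               ≈⟨ -‿cong (rest≈ φ ext) ⟨
      - rest φ                     ∎
      where
      -- Neither chosen column is 0 here, so column 0 remains and heads the enumeration.
      lift⁺ : (Fin n → Fin (suc (suc n))) → Fin (suc n) → Fin (suc (suc (suc n)))
      lift⁺ e zero    = zero
      lift⁺ e (suc s) = suc (e s)
      shift : PairTerm (suc n) → PairTerm n
      shift φ x y e = φ (suc x) (suc y) (lift⁺ e)
      φ⁺ = shift φ
      -- Both indices are successors, and their two extra signs cancel.
      rest≈ : ∀ φ → Extensional φ → rest φ ≈ pairSum n (shift φ)
      rest≈ φ ext = sumFin-cong (suc (suc n))
        {λ j → - signed (toℕ j) (inner φ j)}
        {λ j → signed (toℕ j) (sumFin (suc n) (tailTerm′ j))} λ j → begin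
        - signed (toℕ j) (inner φ j)
          ≈⟨ -‿cong (signed-cong (toℕ j) (sumFin-neg (suc n) (tailTerm j))) ⟩
        - signed (toℕ j) (- sumFin (suc n) (tailTerm j))
          ≈⟨ -‿cong (signed-neg (toℕ j) (sumFin (suc n) (tailTerm j))) ⟩
        - - signed (toℕ j) (sumFin (suc n) (tailTerm j))
          ≈⟨ -‿involutive _ ⟩
        signed (toℕ j) (sumFin (suc n) (tailTerm j))
          ≈⟨ signed-cong (toℕ j) (sumFin-cong (suc n) {tailTerm j} {tailTerm′ j} λ k →
               signed-cong (toℕ k)
                 (ext (suc j) (suc (punchIn j k)) λ { zero → ≡.refl ; (suc s) → ≡.refl })) ⟩
        signed (toℕ j) (sumFin (suc n) (tailTerm′ j)) ∎
        where
        tailTerm tailTerm′ : Fin (suc (suc n)) → Fin (suc n) → Carrier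
        tailTerm j k = signed (toℕ k)
          (φ (suc j) (suc (punchIn j k)) λ s → punchIn (suc j) (punchIn (suc k) s))
        tailTerm′ j k = signed (toℕ k)
          (shift φ j (punchIn j k) λ s → punchIn j (punchIn k s))

  -- A swap below the first row takes place inside every minor. The swap of the top two rows does
  -- not; there the expansion along both rows is a signed sum over ordered pairs of columns, and
  -- swapping the rows flips the pairs.
  det-adjacentSwap-rows : ∀ n (i : Fin n) A →
    det (suc n) (λ r s → A (adjacentSwap i r) s) ≈ - det (suc n) A
  det-adjacentSwap-rows (suc n) (suc i) A = trans
    (sumFin-cong (suc (suc n)) {λ j → signed (toℕ j) (A zero j · swappedMinor j)}
      {λ j → - cofactor j} λ j → trans
        (signed-cong (toℕ j) (trans
          (*-congˡ (det-adjacentSwap-rows n i λ r s → A (suc r) (punchIn j s)))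
          (sym (-‿distribʳ-* (A zero j) (minor j)))))
        (signed-neg (toℕ j) (A zero j · minor j)))
    (sumFin-neg (suc (suc n)) cofactor)
    where
    minor swappedMinor cofactor : Fin (suc (suc n)) → Carrier
    minor j = det (suc n) λ r s → A (suc r) (punchIn j s)
    swappedMinor j = det (suc n) λ r s → A (suc (adjacentSwap i r)) (punchIn j s)
    cofactor j = signed (toℕ j) (A zero j · minor j)
  det-adjacentSwap-rows (suc n) zero A = begin
    det (suc (suc n)) (λ r s → A (adjacentSwap zero r) s)
      ≈⟨ expand (λ r s → A (adjacentSwap zero r) s) ⟩
    pairSum n (laplace λ r s → A (adjacentSwap zero r) s)
      ≈⟨ pairSum-cong (λ x y e → x∙yz≈y∙xz (A (suc zero) x) (A zero y) (minor A e)) ⟩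
    pairSum n (λ x y → laplace A y x)
      ≈⟨ pairSum-flip n (laplace A) (λ x y p → *-congˡ (*-congˡ
           (det-cong n λ r s → reflexive (≡.cong (A (suc (suc r))) (p s))))) ⟩
    - pairSum n (laplace A)
      ≈⟨ -‿cong (expand A) ⟨
    - det (suc (suc n)) A ∎
    where
    minor : (Fin (suc (suc n)) → Fin (suc (suc n)) → Carrier) →
            (Fin n → Fin (suc (suc n))) → Carrier
    minor B e = det n λ r s → B (suc (suc r)) (e s)
    laplace : (Fin (suc (suc n)) → Fin (suc (suc n)) → Carrier) → PairTerm n
    laplace B x y e = B zero x · (B (suc zero) y · minor B e)
    pairSum-cong : {φ ψ : PairTerm n} → (∀ x y e → φ x y e ≈ ψ x y e) → pairSum n φ ≈ pairSum n ψ
    pairSum-cong {φ} {ψ} p = sumFin-cong (suc (suc n)) {outer φ} {outer ψ} λ j →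
      signed-cong (toℕ j) (sumFin-cong (suc n) {inner φ j} {inner ψ j} λ k →
        signed-cong (toℕ k) (p j (punchIn j k) λ s → punchIn j (punchIn k s)))
      where
      inner : PairTerm n → Fin (suc (suc n)) → Fin (suc n) → Carrier
      inner φ j k = signed (toℕ k) (φ j (punchIn j k) λ s → punchIn j (punchIn k s))
      outer : PairTerm n → Fin (suc (suc n)) → Carrier
      outer φ j = signed (toℕ j) (sumFin (suc n) (inner φ j))
    expand : ∀ B → det (suc (suc n)) B ≈ pairSum n (laplace B)
    expand B = sumFin-cong (suc (suc n))
      {λ j → signed (toℕ j) (B zero j · sumFin (suc n) (cofactor j))}
      {λ j → signed (toℕ j) (sumFin (suc n) (term j))} λ j →
      signed-cong (toℕ j)
        (trans (*-sumFin (suc n) (B zero j) (cofactor j))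
               (sumFin-cong (suc n) {λ k → B zero j · cofactor j k} {term j} λ k →
                 *-signed (toℕ k) (B zero j) (cofactor′ j k)))
      where
      cofactor cofactor′ term : Fin (suc (suc n)) → Fin (suc n) → Carrier
      cofactor′ j k = B (suc zero) (punchIn j k) · minor B λ s → punchIn j (punchIn k s)
      cofactor j k = signed (toℕ k) (cofactor′ j k)
      term j k = signed (toℕ k) (B zero j · cofactor′ j k)

  -- Each letter of a word for `π` acts once on rows and once on columns, so its two signs cancel.
  det-permute : ∀ n (π : Fin n → Fin n) → (∀ {i j} → π i ≡ π j → i ≡ j) → ∀ A →
                det n (λ r s → A (π r) (π s)) ≈ det n A
  det-permute zero    π inj A = refl
  det-permute (suc n) π inj A = trans
    (det-cong (suc n) λ r s → reflexive (≡.cong₂ A (proj₂ word r) (proj₂ word s)))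
    (det-act (proj₁ word) A)
    where
    word = injective⇒word n π inj
    det-act : ∀ w A → det (suc n) (λ r s → A (act w r) (act w s)) ≈ det (suc n) A
    det-act []      A = refl
    det-act (i ∷ w) A = begin
      det (suc n) (λ r s → A (act (i ∷ w) r) (act (i ∷ w) s))
        ≈⟨ det-act w (λ r s → A (adjacentSwap i r) (adjacentSwap i s)) ⟩
      det (suc n) (λ r s → A (adjacentSwap i r) (adjacentSwap i s))
        ≈⟨ det-adjacentSwap-rows n i (λ r s → A r (adjacentSwap i s)) ⟩
      - det (suc n) (λ r s → A r (adjacentSwap i s))
        ≈⟨ -‿cong (det-adjacentSwap-columns n i A) ⟩
      - - det (suc n) A
        ≈⟨ -‿involutive _ ⟩
      det (suc n) A ∎

-- The companion matrix.

shift : ∀ {a} {A : Set a} (0# 1# : A) {n} → Fin n → Fin (suc n) → A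
shift 0# 1# zero    zero    = 1#
shift 0# 1# zero    (suc k) = 0#
shift 0# 1# (suc l) zero    = 0#
shift 0# 1# (suc l) (suc k) = shift 0# 1# l k

module CompanionMatrix {c ℓ} (R : CommutativeRing c ℓ) where
  open CommutativeRing R hiding (zero) renaming (_*_ to _·_)
  open Over R
  open Determinant R using (sumFin-zero)

  -- For X^{n+1} + c 0 X^n + … + c n in the basis X^n, …, X, 1: listing the powers in
  -- decreasing order puts the coefficients in the first column, so that Laplace
  -- expansion along the first row has only two terms.
  companion : ∀ {n} → (Fin (suc n) → Carrier) → Mat (suc n)
  companion c k zero    = - c k
  companion c k (suc l) = shift 0# 1# l k

  -- With powers in decreasing order, appending a zero coefficient is multiplication by x.
  extend : ∀ {n} → (Fin n → Carrier) → Fin (suc n) → Carrier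
  extend {zero}  v k       = 0#
  extend {suc n} v zero    = v zero
  extend {suc n} v (suc k) = extend (λ i → v (suc i)) k

  shift-action : ∀ n k (v : Fin n → Carrier) →
                 sumFin n (λ l → shift 0# 1# l k · v l) ≈ extend v k
  shift-action zero    k       v = refl
  shift-action (suc n) zero    v =
    trans (+-cong (*-identityˡ _) (sumFin-zero n λ _ → zeroˡ _)) (+-identityʳ _)
  shift-action (suc n) (suc k) v =
    trans (+-cong (zeroˡ _) (shift-action n k λ i → v (suc i))) (+-identityˡ _)

-- Characteristic polynomial and powers of the companion matrix.

module CharacteristicPolynomial {c ℓ c′ ℓ′}
  (R : CommutativeRing c ℓ) (S : CommutativeRing c′ ℓ′)
  (ι : CommutativeRing.Carrier R → CommutativeRing.Carrier S)
  (hom : IsRingHomomorphism (CommutativeRing.rawRing R) (CommutativeRing.rawRing S) ι)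
  (x : CommutativeRing.Carrier S)
  where
  private module R = CommutativeRing R
  open R using () renaming (Carrier to K)
  open CommutativeRing S hiding (zero) renaming (_*_ to _·_)
  open Over R using (Mat; _≈ₘ_; _^ₘ_; Iₘ; δ)
  open CompanionMatrix R
  open IsRingHomomorphism hom
    using (⟦⟧-cong; +-homo; *-homo; -‿homo; 0#-homo; 1#-homo)
  open Det _+_ _·_ -_ 0# 1# using (det; sumFin)
  open Determinant S using (det-cong; sumFin-zero; det-zeroColumn; signed-cong; signed-zero)
  open RingProperties ring using (-‿involutive; -‿distribˡ-*)
  open RingProperties R.ring using ()
    renaming (-‿involutive to R-involutive; -0#≈0# to R-0#≈0#; -1*x≈-x to R-1*x≈-x)
  open import Algebra.Properties.Semiring.Exp semiring using () renaming (_^_ to _↑_)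
  open import Algebra.Solver.Ring.NaturalCoefficients.Default commutativeSemiring
    using (solve; _:=_; _:+_; _:*_)
  open SetoidReasoning setoid

  -- h 0 x^{n-1} + … + h (n-1)
  eval : ∀ n → (Fin n → Carrier) → Carrier
  eval zero    h = 0#
  eval (suc n) h = h zero · x ↑ n + eval n (λ k → h (suc k))

  eval-cong : ∀ n {h h′} → (∀ k → h k ≈ h′ k) → eval n h ≈ eval n h′
  eval-cong zero    p = refl
  eval-cong (suc n) p = +-cong (*-congʳ (p zero)) (eval-cong n λ k → p (suc k))

  -- The columns of charMatrix (companion v) other than the first.
  subdiagonal : ∀ {n} → Fin n → Fin (suc n) → Carrier
  subdiagonal zero    zero          = - 1#
  subdiagonal zero    (suc zero)    = x
  subdiagonal zero    (suc (suc k)) = 0#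
  subdiagonal (suc l) zero          = 0#
  subdiagonal (suc l) (suc k)       = subdiagonal l k

  -- Upper triangular, with x on the diagonal and -1 just above it. Every minor except the first
  -- keeps column 0, which is zero below the top row.
  det-triangular : ∀ n → det n (λ r s → subdiagonal s (suc r)) ≈ x ↑ n
  det-triangular zero    = refl
  det-triangular (suc n) = begin
    det (suc n) (λ r s → subdiagonal s (suc r))
      ≈⟨ +-cong (*-congˡ (det-triangular n)) (sumFin-zero n {tailTerm} (λ j →
           trans (signed-cong (suc (toℕ j)) (vanish j)) (signed-zero (suc (toℕ j))))) ⟩
    x · x ↑ n + 0#
      ≈⟨ +-identityʳ _ ⟩
    x · x ↑ n ∎
    where
    open Det _+_ _·_ -_ 0# 1# using (signed)
    minor tailTerm : Fin n → Carrier
    minor j = det n λ r s → subdiagonal (punchIn (suc j) s) (suc (suc r))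
    tailTerm j = signed (suc (toℕ j)) (subdiagonal (suc j) (suc zero) · minor j)
    vanish : ∀ j → subdiagonal (suc j) (suc zero) · minor j ≈ 0#
    vanish j = trans (*-congˡ (minor≈0 j)) (zeroʳ _)
      where
      minor≈0 : ∀ {n} (j : Fin n) →
        det n (λ r s → subdiagonal (punchIn (suc j) s) (suc (suc r))) ≈ 0#
      minor≈0 {suc n} j =
        det-zeroColumn n (λ r s → subdiagonal (punchIn (suc j) s) (suc (suc r))) λ _ → refl

  bordered : ∀ {n} → (Fin (suc n) → Carrier) → Fin (suc n) → Fin (suc n) → Carrier
  bordered h k zero    = h k
  bordered h k (suc l) = subdiagonal l k

  -- The top row is `h zero`, -1, 0, ... . Deleting column 0 leaves the triangular matrix; deleting
  -- column 1 leaves the bordered matrix of the rest of `h`, and the entry -1 cancels the cofactor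
  -- sign. An arbitrary `h` is taken because the x in the top left entry does not recur in the
  -- smaller matrix.
  det-bordered : ∀ n (h : Fin (suc n) → Carrier) → det (suc n) (bordered h) ≈ eval (suc n) h
  det-bordered zero    h = refl
  det-bordered (suc n) h = begin
    h zero · det (suc n) (λ r s → subdiagonal s (suc r)) +
      (- (- 1# · det (suc n) minor) + sumFin n tailTerm)
      ≈⟨ +-cong (*-congˡ (det-triangular (suc n)))
           (+-cong (-‿cong (sym (-‿distribˡ-* _ _)))
                   (sumFin-zero n {tailTerm} λ j →
                     trans (signed-cong (suc (suc (toℕ j))) (zeroˡ (tailMinor j)))
                           (signed-zero (suc (suc (toℕ j)))))) ⟩
    h zero · x ↑ suc n + (- - (1# · det (suc n) minor) + 0#)
      ≈⟨ +-congˡ (trans (+-identityʳ _) (trans (-‿involutive _) (*-identityˡ _))) ⟩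
    h zero · x ↑ suc n + det (suc n) minor
      ≈⟨ +-congˡ (det-cong (suc n) {minor} {bordered λ k → h (suc k)}
           λ r → λ { zero → refl ; (suc s) → refl }) ⟩
    h zero · x ↑ suc n + det (suc n) (bordered λ k → h (suc k))
      ≈⟨ +-congˡ (det-bordered n λ k → h (suc k)) ⟩
    h zero · x ↑ suc n + eval (suc n) (λ k → h (suc k)) ∎
    where
    open Det _+_ _·_ -_ 0# 1# using (signed)
    minor : Fin (suc n) → Fin (suc n) → Carrier
    minor r s = bordered h (suc r) (punchIn (suc zero) s)
    tailMinor tailTerm : Fin n → Carrier
    tailMinor j = det (suc n) λ r s → bordered h (suc r) (punchIn (suc (suc j)) s)
    tailTerm j = signed (suc (suc (toℕ j))) (0# · tailMinor j)

  combination : ∀ n → (Fin n → K) → Carrier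
  combination n v = eval n λ k → ι (v k)

  combination-cong : ∀ n {v w} → (∀ k → v k R.≈ w k) → combination n v ≈ combination n w
  combination-cong n p = eval-cong n λ k → ⟦⟧-cong (p k)

  -- For x = `Xₚ` and ι = `constₚ` this unfolds to the matrix inside `charPoly`.
  charMatrix : ∀ {n} → Mat n → Fin n → Fin n → Carrier
  charMatrix A i j = (if does (i Fin.≟ j) then x else 0#) + ι (R.- A i j)

  det-charMatrix-companion : ∀ n (v : Fin (suc n) → K) →
    det (suc n) (charMatrix (companion v)) ≈ x ↑ suc n + combination (suc n) v
  det-charMatrix-companion n v = begin
    det (suc n) (charMatrix (companion v))
      ≈⟨ det-cong (suc n) {charMatrix (companion v)} {bordered h} entries ⟩
    det (suc n) (bordered h)
      ≈⟨ det-bordered n h ⟩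
    (x + ι (v zero)) · x ↑ n + combination n (λ k → v (suc k))
      ≈⟨ +-congʳ (distribʳ _ _ _) ⟩
    (x · x ↑ n + ι (v zero) · x ↑ n) + combination n (λ k → v (suc k))
      ≈⟨ +-assoc _ _ _ ⟩
    x ↑ suc n + combination (suc n) v ∎
    where
    h : Fin (suc n) → Carrier
    h zero    = x + ι (v zero)
    h (suc k) = ι (v (suc k))
    ι-0≈0 : 0# + ι (R.- R.0#) ≈ 0#
    ι-0≈0 = trans (+-identityˡ _) (trans (⟦⟧-cong R-0#≈0#) 0#-homo)
    shift-entries : ∀ {n} (l : Fin n) k →
      (if does (k Fin.≟ suc l) then x else 0#) + ι (R.- shift R.0# R.1# l k) ≈ subdiagonal l k
    shift-entries zero    zero          =
      trans (+-identityˡ _) (trans (-‿homo R.1#) (-‿cong 1#-homo))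
    shift-entries zero    (suc zero)    =
      trans (+-congˡ (trans (⟦⟧-cong R-0#≈0#) 0#-homo)) (+-identityʳ x)
    shift-entries zero    (suc (suc k)) = ι-0≈0
    shift-entries (suc l) zero          = ι-0≈0
    shift-entries (suc l) (suc k)       = shift-entries l k
    entries : ∀ k l → charMatrix (companion v) k l ≈ bordered h k l
    entries zero    zero    = +-congˡ (⟦⟧-cong (R-involutive (v zero)))
    entries (suc k) zero    = trans (+-identityˡ _) (⟦⟧-cong (R-involutive (v (suc k))))
    entries k       (suc l) = shift-entries l k

  combination-zero : ∀ n → combination n (λ _ → R.0#) ≈ 0#
  combination-zero zero    = refl
  combination-zero (suc n) =
    trans (+-cong (trans (*-congʳ 0#-homo) (zeroˡ _)) (combination-zero n)) (+-identityˡ 0#)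

  -- One induction for several uses: `a` is the leading coordinate in `companion-step`, 1 for a sum
  -- and -1 for a difference.
  combination-linear : ∀ n a v w →
    combination n (λ k → v k R.* a R.+ w k) ≈ combination n v · ι a + combination n w
  combination-linear zero    a v w = sym (trans (+-identityʳ _) (zeroˡ _))
  combination-linear (suc n) a v w = begin
    ι (v zero R.* a R.+ w zero) · x ↑ n + combination n (λ k → v (suc k) R.* a R.+ w (suc k))
      ≈⟨ +-cong (*-congʳ (trans (+-homo _ _) (+-congʳ (*-homo _ _)))) (combination-linear n a _ _) ⟩
    (ι (v zero) · ι a + ι (w zero)) · x ↑ n +
      (combination n (λ k → v (suc k)) · ι a + combination n (λ k → w (suc k)))
      ≈⟨ solve 6 (λ v₀ a w₀ p v w → (v₀ :* a :+ w₀) :* p :+ (v :* a :+ w) :=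
           (v₀ :* p :+ v) :* a :+ (w₀ :* p :+ w)) refl (ι (v zero)) (ι a) (ι (w zero)) (x ↑ n) _ _ ⟩
    combination (suc n) v · ι a + combination (suc n) w ∎

  combination-extend : ∀ n v → combination (suc n) (extend v) ≈ x · combination n v
  combination-extend zero    v =
    trans (+-identityʳ _) (trans (*-congʳ 0#-homo) (trans (zeroˡ _) (sym (zeroʳ x))))
  combination-extend (suc n) v = begin
    ι (v zero) · (x · x ↑ n) + combination (suc n) (extend λ k → v (suc k))
      ≈⟨ +-congˡ (combination-extend n λ k → v (suc k)) ⟩
    ι (v zero) · (x · x ↑ n) + x · combination n (λ k → v (suc k))
      ≈⟨ solve 4 (λ a x p q → a :* (x :* p) :+ x :* q := x :* (a :* p :+ q)) 
           refl (ι (v zero)) x (x ↑ n) _ ⟩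
    x · combination (suc n) v ∎

  combination-δ-last : ∀ n → combination (suc n) (λ k → δ k (fromℕ n)) ≈ 1#
  combination-δ-last zero    = trans (+-identityʳ _) (trans (*-identityʳ _) 1#-homo)
  combination-δ-last (suc n) =
    trans (+-cong (trans (*-congʳ 0#-homo) (zeroˡ _)) (combination-δ-last n)) (+-identityˡ 1#)

  module _ (n : ℕ) (v : Fin (suc n) → K) (f : Carrier)
           (f≈ : f ≈ x ↑ suc n + combination (suc n) v) where

    -- Multiplication by x pushes only the leading term out of the range of the basis. Rewriting its
    -- power of x through `f` leaves the leading coordinate `w zero` as the quotient.
    companion-step : ∀ w →
      x · combination (suc n) w ≈
      combination (suc n) (λ k → Over.sumFin R (suc n) λ l → companion v k l R.* w l) + f · ι (w zero)
    companion-step w = sym (begin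
      combination (suc n) (λ k → Over.sumFin R (suc n) λ l → companion v k l R.* w l) + f · ι w₀
        ≈⟨ +-cong (combination-cong (suc n) {λ k → Over.sumFin R (suc n) λ l → companion v k l R.* w l}
             λ k → R.+-congˡ (shift-action n k w⁺)) (*-congʳ f≈) ⟩
      combination (suc n) (λ k → (R.- v k) R.* w₀ R.+ extend w⁺ k) + (x ↑ suc n + V) · ι w₀
        ≈⟨ +-congʳ (combination-linear (suc n) w₀ (λ k → R.- v k) (extend w⁺)) ⟩
      (V⁻ · ι w₀ + combination (suc n) (extend w⁺)) + (x ↑ suc n + V) · ι w₀
        ≈⟨ +-congʳ (+-congˡ (combination-extend n w⁺)) ⟩
      (V⁻ · ι w₀ + x · W) + (x · x ↑ n + V) · ι w₀
        ≈⟨ solve 6 (λ m w x W p V → (m :* w :+ x :* W) :+ (x :* p :+ V) :* w :=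
             (m :+ V) :* w :+ x :* (w :* p :+ W)) refl V⁻ (ι w₀) x W (x ↑ n) V ⟩
      (V⁻ + V) · ι w₀ + x · combination (suc n) w
        ≈⟨ +-congʳ (trans (*-congʳ V⁻+V≈0) (zeroˡ _)) ⟩
      0# + x · combination (suc n) w
        ≈⟨ +-identityˡ _ ⟩
      x · combination (suc n) w ∎)
      where
      w₀ = w zero
      w⁺ : Fin n → K
      w⁺ k = w (suc k)
      W  = combination n w⁺
      V  = combination (suc n) v
      V⁻ = combination (suc n) λ k → R.- v k
      V⁻+V≈0 : V⁻ + V ≈ 0#
      V⁻+V≈0 = begin
        V⁻ + V           ≈⟨ +-congʳ (trans (*-congˡ 1#-homo) (*-identityʳ _)) ⟨
        V⁻ · ι R.1# + V  ≈⟨ combination-linear (suc n) R.1# (λ k → R.- v k) v ⟨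
        combination (suc n) (λ k → (R.- v k) R.* R.1# R.+ v k)
          ≈⟨ combination-cong (suc n) {λ k → (R.- v k) R.* R.1# R.+ v k} {λ _ → R.0#}
               (λ k → R.trans (R.+-congʳ (R.*-identityʳ (R.- v k))) (R.-‿inverseˡ (v k))) ⟩
        combination (suc n) (λ _ → R.0#)
          ≈⟨ combination-zero (suc n) ⟩
        0# ∎

    -- Column `l` of the power holds the coordinates of x^e times the basis element `l`, modulo `f`;
    -- the witness `h` is the accumulated quotient.
    companion-power : ∀ e l → Σ Carrier λ h →
      x ↑ e · combination (suc n) (λ k → δ k l) ≈
      combination (suc n) (λ k → (companion v ^ₘ e) k l) + f · h
    companion-power zero    l = 0# ,
      trans (*-identityˡ _) (sym (trans (+-congˡ (zeroʳ f)) (+-identityʳ _)))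
    companion-power (suc e) l with companion-power e l
    ... | h , eq = ι (B zero) + x · h , (begin
      (x · x ↑ e) · combination (suc n) (λ k → δ k l)
        ≈⟨ trans (*-assoc _ _ _) (*-congˡ eq) ⟩
      x · (combination (suc n) B + f · h)
        ≈⟨ distribˡ _ _ _ ⟩
      x · combination (suc n) B + x · (f · h)
        ≈⟨ +-congʳ (companion-step B) ⟩
      (C + f · ι (B zero)) + x · (f · h)
        ≈⟨ solve 5 (λ C f b x h → (C :+ f :* b) :+ x :* (f :* h) := C :+ f :* (b :+ x :* h))
             refl C f (ι (B zero)) x h ⟩
      C + f · (ι (B zero) + x · h) ∎)
      where
      B : Fin (suc n) → K
      B k = (companion v ^ₘ e) k l
      C = combination (suc n) λ k → (companion v ^ₘ suc e) k l

    -- The last basis element is 1, so the last column of the power records x^e itself.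
    power≈I⇒divides : ∀ e → (companion v ^ₘ e) ≈ₘ Iₘ →
                      Σ Carrier λ h → f · h ≈ x ↑ e + - 1#
    power≈I⇒divides e p with companion-power e (fromℕ n)
    ... | h , eq = h , sym (begin
      x ↑ e + - 1#
        ≈⟨ +-congʳ (trans (*-congˡ (combination-δ-last n)) (*-identityʳ _)) ⟨
      x ↑ e · combination (suc n) (λ k → δ k (fromℕ n)) + - 1#
        ≈⟨ +-congʳ (trans eq (+-congʳ (trans (combination-cong (suc n) λ k → p k (fromℕ n))
                                             (combination-δ-last n)))) ⟩
      (1# + f · h) + - 1#
        ≈⟨ trans (+-congʳ (+-comm _ _)) (+-assoc _ _ _) ⟩
      f · h + (1# + - 1#)
        ≈⟨ trans (+-congˡ (-‿inverseʳ 1#)) (+-identityʳ _) ⟩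
      f · h ∎)

    -- Half of the converse. That such a combination must vanish is a matter of degrees, which make
    -- sense only once the ring is a polynomial ring.
    divides⇒combination : ∀ e {h} → f · h ≈ x ↑ e + - 1# → ∀ l → Σ Carrier λ h′ →
      f · h′ ≈ combination (suc n) λ k → (companion v ^ₘ e) k l R.+ R.- δ k l
    divides⇒combination e {h} fh≈ l with companion-power e l
    ... | h₀ , eq = h · D + - h₀ , (begin
      f · (h · D + - h₀)
        ≈⟨ trans (distribˡ _ _ _) (+-congʳ (sym (*-assoc _ _ _))) ⟩
      (f · h) · D + f · - h₀
        ≈⟨ +-congʳ (trans (*-congʳ fh≈) (distribʳ _ _ _)) ⟩
      (x ↑ e · D + - 1# · D) + f · - h₀
        ≈⟨ +-congʳ (+-congʳ eq) ⟩
      ((B + f · h₀) + - 1# · D) + f · - h₀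
        ≈⟨ solve 6 (λ B f h m D h′ → ((B :+ f :* h) :+ m :* D) :+ f :* h′ :=
             (D :* m :+ B) :+ f :* (h :+ h′)) refl B f h₀ (- 1#) D (- h₀) ⟩
      (D · - 1# + B) + f · (h₀ + - h₀)
        ≈⟨ +-cong (+-congʳ (*-congˡ (trans (-‿cong (sym 1#-homo)) (sym (-‿homo R.1#)))))
                  (trans (*-congˡ (-‿inverseʳ h₀)) (zeroʳ f)) ⟩
      (D · ι (R.- R.1#) + B) + 0#
        ≈⟨ trans (+-identityʳ _) (sym (combination-linear (suc n) (R.- R.1#) (λ k → δ k l) Bₗ)) ⟩
      combination (suc n) (λ k → δ k l R.* R.- R.1# R.+ (companion v ^ₘ e) k l)
        ≈⟨ combination-cong (suc n) {λ k → δ k l R.* R.- R.1# R.+ Bₗ k} {λ k → Bₗ k R.+ R.- δ k l}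
             (λ k → R.trans (R.+-comm (δ k l R.* R.- R.1#) (Bₗ k)) (R.+-congˡ
               (R.trans (R.*-comm (δ k l) (R.- R.1#)) (R-1*x≈-x (δ k l))))) ⟩
      combination (suc n) (λ k → (companion v ^ₘ e) k l R.+ R.- δ k l) ∎)
      where
      D = combination (suc n) λ k → δ k l
      Bₗ : Fin (suc n) → K
      Bₗ k = (companion v ^ₘ e) k l
      B = combination (suc n) Bₗ

does-⟨$⟩ʳ : ∀ {n} (π : Permutation n n) i j →
             does (i Fin.≟ j) ≡ does ((π ⟨$⟩ʳ i) Fin.≟ (π ⟨$⟩ʳ j))
does-⟨$⟩ʳ π i j = does-⇔ (mk⇔ (≡.cong (π ⟨$⟩ʳ_)) (Injection.injective (↔⇒↣ π)))
  (i Fin.≟ j) ((π ⟨$⟩ʳ i) Fin.≟ (π ⟨$⟩ʳ j))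

-- Matrix powers and simultaneous reindexing of rows and columns.

module MatrixPower {c ℓ} (R : CommutativeRing c ℓ) where
  open CommutativeRing R hiding (zero) renaming (_*_ to _·_)
  open Over R
  open Determinant R using (sumFin-cong; sumFin-zero; *-sumFin)
  open import Algebra.Properties.CommutativeMonoid.Sum +-commutativeMonoid
    using (sum; sum-permute; ∑-comm)
  open SetoidReasoning setoid

  sumFin≡sum : ∀ n f → sumFin n f ≡ sum f
  sumFin≡sum zero    f = ≡.refl
  sumFin≡sum (suc n) f = ≡.cong (f zero +_) (sumFin≡sum n λ i → f (suc i))

  sumFin-permute : ∀ {n} f (π : Permutation n n) → sumFin n f ≈ sumFin n λ i → f (π ⟨$⟩ʳ i)
  sumFin-permute {n} f π = begin
    sumFin n f                      ≡⟨ sumFin≡sum n f ⟩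
    sum f                           ≈⟨ sum-permute f π ⟩
    sum (λ i → f (π ⟨$⟩ʳ i))        ≡⟨ sumFin≡sum n (λ i → f (π ⟨$⟩ʳ i)) ⟨
    sumFin n (λ i → f (π ⟨$⟩ʳ i))   ∎

  sumFin-comm : ∀ m n (f : Fin m → Fin n → Carrier) →
    sumFin m (λ i → sumFin n (f i)) ≈ sumFin n (λ j → sumFin m λ i → f i j)
  sumFin-comm m n f = begin
    sumFin m (λ i → sumFin n (f i))
      ≈⟨ sumFin-cong m (λ i → reflexive (sumFin≡sum n (f i))) ⟩
    sumFin m (λ i → sum (f i))
      ≡⟨ sumFin≡sum m _ ⟩
    sum (λ i → sum (f i))
      ≈⟨ ∑-comm f ⟩
    sum (λ j → sum λ i → f i j)
      ≡⟨ sumFin≡sum n _ ⟨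
    sumFin n (λ j → sum λ i → f i j)
      ≈⟨ sumFin-cong n (λ j → reflexive (sumFin≡sum m λ i → f i j)) ⟨
    sumFin n (λ j → sumFin m λ i → f i j) ∎

  *ₘ-assoc : ∀ {n} (A B C : Mat n) → ((A *ₘ B) *ₘ C) ≈ₘ (A *ₘ (B *ₘ C))
  *ₘ-assoc {n} A B C i j = begin
    sumFin n (λ k → sumFin n (λ l → A i l · B l k) · C k j)
      ≈⟨ sumFin-cong n (λ k → trans (*-comm _ _) (*-sumFin n (C k j) λ l → A i l · B l k)) ⟩
    sumFin n (λ k → sumFin n λ l → C k j · (A i l · B l k))
      ≈⟨ sumFin-comm n n (λ k l → C k j · (A i l · B l k)) ⟩
    sumFin n (λ l → sumFin n λ k → C k j · (A i l · B l k))
      ≈⟨ sumFin-cong n (λ l → sumFin-cong n λ k → trans (*-comm _ _) (*-assoc _ _ _)) ⟩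
    sumFin n (λ l → sumFin n λ k → A i l · (B l k · C k j))
      ≈⟨ sumFin-cong n (λ l → *-sumFin n (A i l) λ k → B l k · C k j) ⟨
    sumFin n (λ l → A i l · sumFin n λ k → B l k · C k j) ∎

  ^ₘ-cong : ∀ {n} {A B : Mat n} → A ≈ₘ B → ∀ e → (A ^ₘ e) ≈ₘ (B ^ₘ e)
  ^ₘ-cong     p zero    i j = refl
  ^ₘ-cong {n} p (suc e) i j = sumFin-cong n λ k → *-cong (p i k) (^ₘ-cong p e k j)

  sumFin-δˡ : ∀ {n} i (f : Fin n → Carrier) → sumFin n (λ k → δ i k · f k) ≈ f i
  sumFin-δˡ {suc n} zero    f =
    trans (+-cong (*-identityˡ _) (sumFin-zero n λ _ → zeroˡ _)) (+-identityʳ _)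
  sumFin-δˡ {suc n} (suc i) f =
    trans (+-cong (zeroˡ _) (sumFin-δˡ i λ k → f (suc k))) (+-identityˡ _)

  sumFin-δʳ : ∀ {n} j (f : Fin n → Carrier) → sumFin n (λ k → f k · δ k j) ≈ f j
  sumFin-δʳ {suc n} zero    f =
    trans (+-cong (*-identityʳ _) (sumFin-zero n λ _ → zeroʳ _)) (+-identityʳ _)
  sumFin-δʳ {suc n} (suc j) f =
    trans (+-cong (zeroʳ _) (sumFin-δʳ j λ k → f (suc k))) (+-identityˡ _)

  ^ₘ-commutes : ∀ {n} (A : Mat n) e → ((A ^ₘ e) *ₘ A) ≈ₘ (A *ₘ (A ^ₘ e))
  ^ₘ-commutes     A zero    i j =
    trans (sumFin-δˡ i λ k → A k j) (sym (sumFin-δʳ j λ k → A i k))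
  ^ₘ-commutes {n} A (suc e) i j =
    trans (*ₘ-assoc A (A ^ₘ e) A i j) (sumFin-cong n λ k → *-congˡ (^ₘ-commutes A e k j))

  -- The inverse is the power with exponent one below the order. Powers unfold with `A` on the left,
  -- so the other product needs `^ₘ-commutes`.
  finiteOrder⇒invertible : ∀ {n} {A : Mat n} {e} → HasOrder A e → Invertible A
  finiteOrder⇒invertible {A = A} {suc e} (_ , A^e≈I , _) =
    (A ^ₘ e) , A^e≈I , λ i j → trans (^ₘ-commutes A e i j) (A^e≈I i j)

  ^ₘ-reindex : ∀ {n} (π : Permutation n n) (A : Mat n) e i j →
    ((λ r s → A (π ⟨$⟩ʳ r) (π ⟨$⟩ʳ s)) ^ₘ e) i j ≈ (A ^ₘ e) (π ⟨$⟩ʳ i) (π ⟨$⟩ʳ j)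
  ^ₘ-reindex     π A zero    i j = reflexive (≡.cong (λ b → if b then 1# else 0#) (does-⟨$⟩ʳ π i j))
  ^ₘ-reindex {n} π A (suc e) i j = begin
    sumFin n (λ k → A (π ⟨$⟩ʳ i) (π ⟨$⟩ʳ k) · _)
      ≈⟨ sumFin-cong n (λ k → *-congˡ (^ₘ-reindex π A e k j)) ⟩
    sumFin n (λ k → A (π ⟨$⟩ʳ i) (π ⟨$⟩ʳ k) · (A ^ₘ e) (π ⟨$⟩ʳ k) (π ⟨$⟩ʳ j))
      ≈⟨ sumFin-permute (λ k → A (π ⟨$⟩ʳ i) k · (A ^ₘ e) k (π ⟨$⟩ʳ j)) π ⟨
    (A ^ₘ suc e) (π ⟨$⟩ʳ i) (π ⟨$⟩ʳ j) ∎

  ^ₘ-reindex-identity : ∀ {n} (π : Permutation n n) (A : Mat n) e →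
    ((λ r s → A (π ⟨$⟩ʳ r) (π ⟨$⟩ʳ s)) ^ₘ e) ≈ₘ Iₘ ⇔ (A ^ₘ e) ≈ₘ Iₘ
  ^ₘ-reindex-identity π A e = mk⇔
    (λ p i j → begin
      (A ^ₘ e) i j
        ≡⟨ ≡.cong₂ (A ^ₘ e) (inverseʳ π) (inverseʳ π) ⟨
      (A ^ₘ e) (π ⟨$⟩ʳ (π ⟨$⟩ˡ i)) (π ⟨$⟩ʳ (π ⟨$⟩ˡ j))
        ≈⟨ ^ₘ-reindex π A e _ _ ⟨
      ((λ r s → A (π ⟨$⟩ʳ r) (π ⟨$⟩ʳ s)) ^ₘ e) (π ⟨$⟩ˡ i) (π ⟨$⟩ˡ j)
        ≈⟨ p _ _ ⟩
      δ (π ⟨$⟩ˡ i) (π ⟨$⟩ˡ j)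
        -- Zeroth powers are `Iₘ`, so this instance says that `δ` is invariant under `π`.
        ≈⟨ ^ₘ-reindex π Iₘ 0 (π ⟨$⟩ˡ i) (π ⟨$⟩ˡ j) ⟩
      δ (π ⟨$⟩ʳ (π ⟨$⟩ˡ i)) (π ⟨$⟩ʳ (π ⟨$⟩ˡ j))
        ≡⟨ ≡.cong₂ δ (inverseʳ π) (inverseʳ π) ⟩
      δ i j ∎)
    (λ p i j → trans (^ₘ-reindex π A e i j)
              (trans (p _ _) (sym (^ₘ-reindex π Iₘ 0 i j))))

-- Polynomials: coefficients, degrees and divisibility by a monic polynomial.

descending : ∀ {a} {A : Set a} n → (ℕ → A) → Fin n → A
descending (suc n) c zero    = c n
descending (suc n) c (suc k) = descending n c k

module CompanionPolynomial {c ℓ} (R : CommutativeRing c ℓ) where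
  open CommutativeRing R hiding (zero) renaming (_*_ to _·_)
  open Over R
  open PolynomialRing R
  open CompanionMatrix R
  private module P = CommutativeRing polynomialRing
  open import Algebra.Properties.Semiring.Exp P.semiring using () renaming (_^_ to _↑_)
  open RingProperties ring using (x∙y⁻¹≈ε⇒x≈y)
  open SetoidReasoning setoid

  constₚ-isRingHomomorphism : IsRingHomomorphism rawRing P.rawRing constₚ
  constₚ-isRingHomomorphism = record
    { isSemiringHomomorphism = record
      { isNearSemiringHomomorphism = record
        { +-isMonoidHomomorphism = record
          { isMagmaHomomorphism = record
            { isRelHomomorphism = record { cong = λ { p zero → p ; p (suc k) → refl } }
            ; homo = λ _ _ _ → refl
            }
          ; ε-homo = λ { zero → refl ; (suc k) → refl }
          }
        ; *-homo = λ { _ _ zero → sym (+-identityʳ _) ; _ _ (suc k) → refl }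
        }
      ; 1#-homo = λ _ → refl
      }
    ; -‿homo = λ _ _ → refl
    }

  open CharacteristicPolynomial R polynomialRing constₚ constₚ-isRingHomomorphism Xₚ

  Xₚ-*-suc : ∀ p k → coeff (Xₚ *ₚ p) (suc k) ≈ coeff p k
  Xₚ-*-suc p k = begin
    coeff (Xₚ *ₚ p) (suc k)
      ≈⟨ coeff-* Xₚ p (suc k) ⟩
    0# · coeff p (suc k) + conv (coeff (constₚ 1#)) (coeff p) k
      ≈⟨ +-cong (zeroˡ _) (sym (coeff-* (constₚ 1#) p k)) ⟩
    0# + coeff (constₚ 1# *ₚ p) k
      ≈⟨ trans (+-identityˡ _) (*ₚ-identityˡ p k) ⟩
    coeff p k ∎

  Xₚ↑≈Xpow : ∀ n → (Xₚ ↑ n) ≈ₚ Xpow n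
  Xₚ↑≈Xpow zero    k       = refl
  Xₚ↑≈Xpow (suc n) zero    = trans (coeff-* Xₚ (Xₚ ↑ n) 0) (zeroˡ _)
  Xₚ↑≈Xpow (suc n) (suc k) = trans (Xₚ-*-suc (Xₚ ↑ n) k) (Xₚ↑≈Xpow n k)

  coeff-Xpow-≡ : ∀ n → coeff (Xpow n) n ≡ 1#
  coeff-Xpow-≡ zero    = ≡.refl
  coeff-Xpow-≡ (suc n) = coeff-Xpow-≡ n

  coeff-Xpow-≢ : ∀ n k → ¬ (n ≡ k) → coeff (Xpow n) k ≡ 0#
  coeff-Xpow-≢ zero    zero    n≢k = contradiction ≡.refl n≢k
  coeff-Xpow-≢ zero    (suc k) n≢k = ≡.refl
  coeff-Xpow-≢ (suc n) zero    n≢k = ≡.refl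
  coeff-Xpow-≢ (suc n) (suc k) n≢k = coeff-Xpow-≢ n k λ eq → n≢k (≡.cong suc eq)

  coeff-combination : ∀ n v k → coeff (combination (suc n) v) k ≈
    v zero · coeff (Xpow n) k + coeff (combination n λ i → v (suc i)) k
  coeff-combination n v k =
    trans (coeff-+ (constₚ (v zero) *ₚ (Xₚ ↑ n)) _ k)
          (+-congʳ (trans (coeff-const-* (v zero) (Xₚ ↑ n) k) (*-congˡ (Xₚ↑≈Xpow n k))))

  combination-degree : ∀ n v k → n ≤ k → coeff (combination n v) k ≈ 0#
  combination-degree zero    v k n≤k = refl
  combination-degree (suc n) v k n<k = begin
    coeff (combination (suc n) v) k
      ≈⟨ coeff-combination n v k ⟩
    v zero · coeff (Xpow n) k + coeff (combination n λ i → v (suc i)) k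
      ≈⟨ +-cong (trans (*-congˡ (reflexive (coeff-Xpow-≢ n k (ℕ.<⇒≢ n<k)))) (zeroʳ _))
                (combination-degree n _ k (ℕ.<⇒≤ n<k)) ⟩
    0# + 0#
      ≈⟨ +-identityˡ 0# ⟩
    0# ∎

  combination-leading : ∀ n v → coeff (combination (suc n) v) n ≈ v zero
  combination-leading n v = begin
    coeff (combination (suc n) v) n
      ≈⟨ coeff-combination n v n ⟩
    v zero · coeff (Xpow n) n + coeff (combination n λ i → v (suc i)) n
      ≈⟨ +-cong (trans (*-congˡ (reflexive (coeff-Xpow-≡ n))) (*-identityʳ _))
                (combination-degree n _ n ℕ.≤-refl) ⟩
    v zero + 0#
      ≈⟨ +-identityʳ _ ⟩
    v zero ∎

  -- The top coefficient sees only `v zero`; once that vanishes, the remaining combination is zero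
  -- as well.
  combination-injective : ∀ n v → combination n v ≈ₚ [] → ∀ k → v k ≈ 0#
  combination-injective (suc n) v p zero    = trans (sym (combination-leading n v)) (p n)
  combination-injective (suc n) v p (suc k) = combination-injective n (λ i → v (suc i)) (λ j → begin
    coeff (combination n λ i → v (suc i)) j
      ≈⟨ +-identityˡ _ ⟨
    0# + coeff (combination n λ i → v (suc i)) j
      ≈⟨ +-congʳ (trans (*-congʳ (combination-injective (suc n) v p zero)) (zeroˡ _)) ⟨
    v zero · coeff (Xpow n) j + coeff (combination n λ i → v (suc i)) j
      ≈⟨ coeff-combination n v j ⟨
    coeff (combination (suc n) v) j
      ≈⟨ p j ⟩
    0# ∎) k

  combination-descending : ∀ n c k → k < n → coeff (combination n (descending n c)) k ≈ c k
  combination-descending (suc n) c k k<1+n with k ℕ.≟ n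
  ... | yes ≡.refl = combination-leading n (descending (suc n) c)
  ... | no k≢n = begin
    coeff (combination (suc n) (descending (suc n) c)) k
      ≈⟨ coeff-combination n (descending (suc n) c) k ⟩
    c n · coeff (Xpow n) k + coeff (combination n (descending n c)) k
      ≈⟨ +-cong (trans (*-congˡ (reflexive (coeff-Xpow-≢ n k λ eq → k≢n (≡.sym eq)))) (zeroʳ _))
                (combination-descending n c k (ℕ.≤∧≢⇒< (ℕ.≤-pred k<1+n) k≢n)) ⟩
    0# + c k
      ≈⟨ +-identityˡ _ ⟩
    c k ∎

  monic≈combination : ∀ n f → MonicOfDegree n f →
    f ≈ₚ ((Xₚ ↑ n) +ₚ combination n (descending n (coeff f)))
  monic≈combination n f (leading , high) k = sym (begin
    coeff ((Xₚ ↑ n) +ₚ combination n (descending n (coeff f))) k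
      ≈⟨ trans (coeff-+ (Xₚ ↑ n) _ k) (+-congʳ (Xₚ↑≈Xpow n k)) ⟩
    coeff (Xpow n) k + coeff (combination n (descending n (coeff f))) k
      ≈⟨ split (ℕ.<-cmp k n) ⟩
    coeff f k ∎)
    where
    split : Tri (k < n) (k ≡ n) (n < k) →
      coeff (Xpow n) k + coeff (combination n (descending n (coeff f))) k ≈ coeff f k
    split (tri< k<n k≢n _) =
      trans (+-cong (reflexive (coeff-Xpow-≢ n k λ eq → k≢n (≡.sym eq)))
                    (combination-descending n (coeff f) k k<n)) (+-identityˡ _)
    split (tri≈ _ ≡.refl _) =
      trans (+-cong (reflexive (coeff-Xpow-≡ n)) (combination-degree n _ n ℕ.≤-refl))
            (trans (+-identityʳ _) (sym leading))
    split (tri> _ k≢n n<k) =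
      trans (+-cong (reflexive (coeff-Xpow-≢ n k λ eq → k≢n (≡.sym eq)))
                    (combination-degree n _ k (ℕ.<⇒≤ n<k)))
            (trans (+-identityˡ _) (sym (high k n<k)))

  -- A list may end in zeros, so no leading coefficient of `h` is at hand, and the induction removes
  -- the constant term instead. Its product with `f` does not reach beyond degree `d`, so the tail
  -- satisfies the same hypothesis and vanishes; coefficient `d` then gives `b`.
  monic-multiple≈0 : ∀ d f → MonicOfDegree d f → ∀ h →
    (∀ k → d ≤ k → coeff (h *ₚ f) k ≈ 0#) → h ≈ₚ []
  monic-multiple≈0 d f monic [] p k = refl
  monic-multiple≈0 d f monic@(leading , high) (b ∷ h) p = λ where
      zero    → constant d leading p
      (suc k) → h≈0 k
    where
    unfold : ∀ k → coeff ((b ∷ h) *ₚ f) (suc k) ≈ b · coeff f (suc k) + coeff (h *ₚ f) k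
    unfold k = trans (coeff-* (b ∷ h) f (suc k)) (+-congˡ (sym (coeff-* h f k)))
    h≈0 : h ≈ₚ []
    h≈0 = monic-multiple≈0 d f monic h λ k d≤k → begin
      coeff (h *ₚ f) k                           ≈⟨ +-identityˡ _ ⟨
      0# + coeff (h *ₚ f) k
        ≈⟨ +-congʳ (trans (*-congˡ (high (suc k) (s≤s d≤k))) (zeroʳ b)) ⟨
      b · coeff f (suc k) + coeff (h *ₚ f) k     ≈⟨ unfold k ⟨
      coeff ((b ∷ h) *ₚ f) (suc k)               ≈⟨ p (suc k) (ℕ.m≤n⇒m≤1+n d≤k) ⟩
      0#                                         ∎
    hf≈0 : ∀ k → coeff (h *ₚ f) k ≈ 0#
    hf≈0 k = trans (coeff-* h f k) (trans (conv-cong h≈0 (λ _ → refl) k) (conv-zeroˡ _ k))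
    constant : ∀ d → coeff f d ≈ 1# → (∀ k → d ≤ k → coeff ((b ∷ h) *ₚ f) k ≈ 0#) → b ≈ 0#
    constant d f_d≈1 p = begin
      b                        ≈⟨ *-identityʳ b ⟨
      b · 1#                   ≈⟨ *-congˡ f_d≈1 ⟨
      b · coeff f d            ≈⟨ top d ⟨
      coeff ((b ∷ h) *ₚ f) d   ≈⟨ p d ℕ.≤-refl ⟩
      0#                       ∎
      where
      top : ∀ d → coeff ((b ∷ h) *ₚ f) d ≈ b · coeff f d
      top zero    = coeff-* (b ∷ h) f 0
      top (suc d) = trans (unfold d) (trans (+-congˡ (hf≈0 d)) (+-identityʳ _))

  module _ (n : ℕ) (f : Poly) (monic : MonicOfDegree (suc n) f) where

    coefficients : Fin (suc n) → Carrier
    coefficients = descending (suc n) (coeff f)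

    charPoly-companion : charPoly (companion coefficients) ≈ₚ f
    charPoly-companion k =
      trans (det-charMatrix-companion n coefficients k) (sym (monic≈combination (suc n) f monic k))

    X↑e-1≈ : ∀ e → ((Xₚ ↑ e) +ₚ (-ₚ constₚ 1#)) ≈ₚ (Xpow e +ₚ constₚ (- 1#))
    X↑e-1≈ e = +ₚ-cong {Xₚ ↑ e} {Xpow e} (Xₚ↑≈Xpow e) (λ _ → refl)

    -- Backwards, each column of the power minus the identity gives a multiple of `f` of degree
    -- below that of `f`. The cofactor is therefore zero, and so is the column.
    companion-power⇔divides : ∀ e →
      (companion coefficients ^ₘ e) ≈ₘ Iₘ ⇔ f ∣ₚ (Xpow e +ₚ constₚ (- 1#))
    companion-power⇔divides e = mk⇔ to from
      where
      f≈ = monic≈combination (suc n) f monic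
      to : (companion coefficients ^ₘ e) ≈ₘ Iₘ → f ∣ₚ (Xpow e +ₚ constₚ (- 1#))
      to p = proj₁ multiple , λ k → trans (proj₂ multiple k) (X↑e-1≈ e k)
        where
        multiple : Σ Poly λ h → (f *ₚ h) ≈ₚ ((Xₚ ↑ e) +ₚ (-ₚ constₚ 1#))
        multiple = power≈I⇒divides n coefficients f f≈ e p
      module _ (divides : f ∣ₚ (Xpow e +ₚ constₚ (- 1#))) (j : Fin (suc n)) where
        difference : Fin (suc n) → Carrier
        difference k = (companion coefficients ^ₘ e) k j + - δ k j
        multiple : Σ Poly λ h → (f *ₚ h) ≈ₚ combination (suc n) difference
        multiple = divides⇒combination n coefficients f f≈ e {proj₁ divides}
          (λ k → trans (proj₂ divides k) (sym (X↑e-1≈ e k))) j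
        h = proj₁ multiple
        h≈0 : h ≈ₚ []
        h≈0 = monic-multiple≈0 (suc n) f monic h λ k d≤k →
          trans (*ₚ-comm h f k)
         (trans (proj₂ multiple k) (combination-degree (suc n) difference k d≤k))
        combination≈0 : combination (suc n) difference ≈ₚ []
        combination≈0 k =
          trans (sym (proj₂ multiple k))
         (trans (*ₚ-comm f h k)
                (*ₚ-cong {h} {[]} {f} {f} h≈0 (λ _ → refl) k))
      from : f ∣ₚ (Xpow e +ₚ constₚ (- 1#)) → (companion coefficients ^ₘ e) ≈ₘ Iₘ
      from divides i j = x∙y⁻¹≈ε⇒x≈y ((companion coefficients ^ₘ e) i j) (δ i j)
        (combination-injective (suc n) (difference divides j) (combination≈0 divides j) i)

-- The companion matrix in block order.

module BlockCompanion {c ℓ} (R : CommutativeRing c ℓ) (m n : ℕ) where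
  open CommutativeRing R hiding (zero) renaming (_*_ to _·_)
  open Over R
  open CompanionMatrix R

  private
    M N : ℕ
    M = suc m
    N = suc n

  -- Basis vector (i , a) is α^{i + n a}; the final reversal is there because
  -- companion lists the powers in decreasing order.
  position : Permutation (N ℕ.* M) (N ℕ.* M)
  position = reverse ↔-∘ (cast-id (ℕ.*-comm M N) ↔-∘
    (↔-sym (*↔× {M} {N}) ↔-∘ (×-comm (Fin N) (Fin M) ↔-∘ *↔× {N} {M})))

  -- The largest index is `m + n * M`, since `N * M` computes to its successor; the exponent is
  -- subtracted from it by the reversal.
  toℕ-position : ∀ i a → toℕ (position ⟨$⟩ʳ combine i a) ≡ (m ℕ.+ n ℕ.* M) ∸ (N ℕ.* toℕ a ℕ.+ toℕ i)
  toℕ-position i a = begin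
    toℕ (position ⟨$⟩ʳ combine i a)
      ≡⟨ ≡.cong (λ p → toℕ (opposite (cast eq (combine (proj₂ p) (proj₁ p)))))
           (remQuot-combine {N} {M} i a) ⟩
    toℕ (opposite (cast eq (combine a i)))
      ≡⟨ opposite-prop (cast eq (combine a i)) ⟩
    (m ℕ.+ n ℕ.* M) ∸ toℕ (cast eq (combine a i))
      ≡⟨ ≡.cong ((m ℕ.+ n ℕ.* M) ∸_) (≡.trans (toℕ-cast eq (combine a i)) (toℕ-combine a i)) ⟩
    (m ℕ.+ n ℕ.* M) ∸ (N ℕ.* toℕ a ℕ.+ toℕ i) ∎
    where
    open ≡.≡-Reasoning
    eq = ℕ.*-comm M N

  -- Multiplying a basis element other than the highest power by x gives its predecessor in the
  -- decreasing list. The hypothesis is numerical because the indices will be values of `position`.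
  companion-subdiagonal : ∀ {d} (v : Fin (suc d) → Carrier) k l l′ → toℕ l ≡ suc (toℕ l′) →
                          companion v k l ≡ δ k l′
  companion-subdiagonal v k (suc l) l′ eq = shift-δ l k l′ (ℕ.suc-injective eq)
    where
    shift-δ : ∀ {d} (l : Fin d) k l′ → toℕ l ≡ toℕ l′ → shift 0# 1# l k ≡ δ k l′
    shift-δ zero    zero    zero     eq = ≡.refl
    shift-δ zero    (suc k) zero     eq = ≡.refl
    shift-δ (suc l) zero    (suc l′) eq = ≡.refl
    shift-δ (suc l) (suc k) (suc l′) eq = shift-δ l k l′ (ℕ.suc-injective eq)

  module _ (v : Fin (N ℕ.* M) → Carrier) where

    permutedCompanion : Mat (N ℕ.* M)
    permutedCompanion I J = companion v (position ⟨$⟩ʳ I) (position ⟨$⟩ʳ J)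

    -- The last block column is free in `bcm`, so it is copied from the permuted matrix.
    blocks : Fin N → Mat M
    blocks i a b = permutedCompanion (combine i a) (combine (fromℕ n) b)

    -- Passing from block `j` to block `j + 1` with the same `b` raises the exponent by one, hence
    -- lowers the position by one. Column (j, b) is thus the unit vector at (j + 1, b).
    permutedCompanion-subdiagonal : ∀ i a j b → ¬ (suc (toℕ j) ≡ N) →
      permutedCompanion (combine i a) (combine j b) ≡
      (if does (toℕ i ℕ.≟ suc (toℕ j)) then δ a b else 0#)
    permutedCompanion-subdiagonal i a j b j+1≢N = ≡.trans
      (companion-subdiagonal v (pos i a) (pos j b) (pos j⁺ b) degree)
      -- As `position` and `combine` are injective, equality of positions is the conjunction of two
      -- equalities, whose Boolean test unfolds to the nested conditional of `bcm`.
      (≡.trans (≡.cong (λ t → if t then 1# else 0#)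
        (does-⇔ (mk⇔ to from) (pos i a Fin.≟ pos j⁺ b) (toℕ i ℕ.≟ suc (toℕ j) ×-dec a Fin.≟ b)))
        (if-∧ (does (toℕ i ℕ.≟ suc (toℕ j)))))
      where
      pos : Fin N → Fin M → Fin (N ℕ.* M)
      pos i a = position ⟨$⟩ʳ combine i a
      j+1<N : suc (toℕ j) < N
      j+1<N = ℕ.≤∧≢⇒< (toℕ<n j) j+1≢N
      j⁺ : Fin N
      j⁺ = fromℕ< j+1<N
      toℕ-j⁺ : toℕ j⁺ ≡ suc (toℕ j)
      toℕ-j⁺ = toℕ-fromℕ< j+1<N
      if-∧ : ∀ s {t} → (if s ∧ t then 1# else 0#) ≡ (if s then (if t then 1# else 0#) else 0#)
      if-∧ true  = ≡.refl
      if-∧ false = ≡.refl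
      ∸-suc-< : ∀ {x y} → x < y → y ∸ x ≡ suc (y ∸ suc x)
      ∸-suc-< {x} (s≤s x≤y) = ℕ.+-∸-assoc 1 x≤y
      degree : toℕ (pos j b) ≡ suc (toℕ (pos j⁺ b))
      degree = begin
        toℕ (pos j b)                                          ≡⟨ toℕ-position j b ⟩
        (m ℕ.+ n ℕ.* M) ∸ (N ℕ.* toℕ b ℕ.+ toℕ j)              ≡⟨ ∸-suc-< bound ⟩
        suc ((m ℕ.+ n ℕ.* M) ∸ suc (N ℕ.* toℕ b ℕ.+ toℕ j))
          ≡⟨ ≡.cong (λ k → suc ((m ℕ.+ n ℕ.* M) ∸ k)) next ⟩
        suc ((m ℕ.+ n ℕ.* M) ∸ (N ℕ.* toℕ b ℕ.+ toℕ j⁺))       ≡⟨ ≡.cong suc (toℕ-position j⁺ b) ⟨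
        suc (toℕ (pos j⁺ b))                                   ∎
        where
        open ≡.≡-Reasoning
        next : suc (N ℕ.* toℕ b ℕ.+ toℕ j) ≡ N ℕ.* toℕ b ℕ.+ toℕ j⁺
        next = ≡.trans (≡.sym (ℕ.+-suc _ _)) (≡.cong (N ℕ.* toℕ b ℕ.+_) (≡.sym toℕ-j⁺))
        -- The exponent of (j⁺, b) is still below `M * N`; subtracting one on both sides gives the
        -- bound.
        bound : N ℕ.* toℕ b ℕ.+ toℕ j < m ℕ.+ n ℕ.* M
        bound = ℕ.≤-pred (≡.subst₂ _<_ (≡.trans (toℕ-combine b j⁺) (≡.sym next)) (ℕ.*-comm M N)
          (toℕ<n (combine b j⁺)))
      to : pos i a ≡ pos j⁺ b → (toℕ i ≡ suc (toℕ j)) × (a ≡ b)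
      to eq with combine-injective i a j⁺ b (Injection.injective (↔⇒↣ position) eq)
      ... | i≡j⁺ , a≡b = ≡.trans (≡.cong toℕ i≡j⁺) toℕ-j⁺ , a≡b
      from : (toℕ i ≡ suc (toℕ j)) × (a ≡ b) → pos i a ≡ pos j⁺ b
      from (i≡ , a≡b) = ≡.cong₂ pos (toℕ-injective (≡.trans i≡ (≡.sym toℕ-j⁺))) a≡b

    bcm-blocks : ∀ I J → bcm M N blocks I J ≡ permutedCompanion I J
    bcm-blocks I J = ≡.trans (block (suc (toℕ j) ℕ.≟ N))
      (≡.cong₂ permutedCompanion (combine-remQuot {N} M I) (combine-remQuot {N} M J))
      where
      i = proj₁ (remQuot {N} M I)
      a = proj₂ (remQuot {N} M I)
      j = proj₁ (remQuot {N} M J)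
      b = proj₂ (remQuot {N} M J)
      block : (j+1≟N : Dec (suc (toℕ j) ≡ N)) →
        (if does j+1≟N then blocks i a b
         else (if does (toℕ i ℕ.≟ suc (toℕ j)) then δ a b else 0#)) ≡
        permutedCompanion (combine i a) (combine j b)
      block (yes j+1≡N) = ≡.cong (λ j → permutedCompanion (combine i a) (combine j b))
        (toℕ-injective (≡.trans (toℕ-fromℕ n) (≡.sym (ℕ.suc-injective j+1≡N))))
      block (no  j+1≢N) = ≡.sym (permutedCompanion-subdiagonal i a j b j+1≢N)

-- Transfer of order and characteristic polynomial to the block form.

module Reindexing {c ℓ} (R : CommutativeRing c ℓ) where
  open CommutativeRing R hiding (zero) renaming (_*_ to _·_)
  open Over R
  open PolynomialRing R
  open CompanionPolynomial R
  open CompanionMatrix R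
  open MatrixPower R
  private module P = CommutativeRing polynomialRing
  open Determinant polynomialRing using (det-cong; det-permute)

  charMatrixₚ : ∀ {n} → Mat n → Fin n → Fin n → Poly
  charMatrixₚ A i j = (if does (i Fin.≟ j) then Xₚ else []) +ₚ constₚ (- A i j)

  charPoly-cong : ∀ {n} {A B : Mat n} → (∀ i j → A i j ≡ B i j) → charPoly A ≈ₚ charPoly B
  charPoly-cong {n} {A} {B} A≡B = det-cong n {charMatrixₚ A} {charMatrixₚ B} λ i j →
    P.reflexive (≡.cong (λ a → (if does (i Fin.≟ j) then Xₚ else []) +ₚ constₚ (- a)) (A≡B i j))

  -- A permutation applied to rows and columns alike keeps the diagonal on the diagonal, so the
  -- characteristic matrix is permuted as a whole and `det-permute` applies.
  charPoly-reindex : ∀ {n} (π : Permutation n n) (A : Mat n) →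
    charPoly (λ r s → A (π ⟨$⟩ʳ r) (π ⟨$⟩ʳ s)) ≈ₚ charPoly A
  charPoly-reindex {n} π A k = trans
    (det-cong n {charMatrixₚ λ r s → A (π ⟨$⟩ʳ r) (π ⟨$⟩ʳ s)}
      {λ i j → charMatrixₚ A (π ⟨$⟩ʳ i) (π ⟨$⟩ʳ j)} (λ i j → P.reflexive
        (≡.cong (λ t → (if t then Xₚ else []) +ₚ constₚ (- A (π ⟨$⟩ʳ i) (π ⟨$⟩ʳ j)))
          (does-⟨$⟩ʳ π i j))) k)
    (det-permute n (π ⟨$⟩ʳ_) (Injection.injective (↔⇒↣ π)) (charMatrixₚ A) k)

  primitive⇒hasOrder : ∀ q d f (prim : Primitive q (suc d) f) → 1 ≤ q ^ suc d ∸ 1 →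
    HasOrder (companion (coefficients d f (proj₁ prim))) (q ^ suc d ∸ 1)
  primitive⇒hasOrder q d f (monic , _ , divides , minimal) 1≤k =
    1≤k ,
    Equivalence.from (companion-power⇔divides d f monic (q ^ suc d ∸ 1)) divides ,
    λ e 1≤e e<k p → minimal e 1≤e e<k (Equivalence.to (companion-power⇔divides d f monic e) p)

  hasOrder-reindex : ∀ {n k} (π : Permutation n n) {A B : Mat n} →
    (∀ i j → B i j ≡ A (π ⟨$⟩ʳ i) (π ⟨$⟩ʳ j)) → HasOrder A k → HasOrder B k
  hasOrder-reindex {k = k} π {A} {B} B≡ (1≤k , A^k≈I , minimal) =
    1≤k , Equivalence.from (power⇔ k) A^k≈I ,
    λ e 1≤e e<k p → minimal e 1≤e e<k (Equivalence.to (power⇔ e) p)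
    where
    B≈ : B ≈ₘ λ i j → A (π ⟨$⟩ʳ i) (π ⟨$⟩ʳ j)
    B≈ i j = reflexive (B≡ i j)
    power⇔ : ∀ e → (B ^ₘ e) ≈ₘ Iₘ ⇔ (A ^ₘ e) ≈ₘ Iₘ
    power⇔ e = mk⇔
      (λ p → Equivalence.to (^ₘ-reindex-identity π A e)
        λ i j → trans (sym (^ₘ-cong B≈ e i j)) (p i j))
      (λ p i j → trans (^ₘ-cong B≈ e i j) (Equivalence.from (^ₘ-reindex-identity π A e) p i j))

1<^ : ∀ {b} e → 1 < b → 1 ≤ e → 1 < b ^ e
-- Here `1 ≤ e` is read as `0 < e`, and `b ^ 0` computes to 1.
1<^ e 1<b 1≤e = ℕ.^-monoʳ-< _ 1<b 1≤e

primePower>1 : ∀ {q} → IsPrimePower q → 1 < q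
primePower>1 (p , k , p-prime , 1≤k , ≡.refl) =
  1<^ k (nonTrivial⇒n>1 p ⦃ prime⇒nonTrivial p-prime ⦄) 1≤k

theorem6p1 : ∀ {c ℓ} (F : CommutativeRing c ℓ) (q : ℕ) → IsPrimePower q →
    Over.IsFiniteField F q →
    (m n : ℕ) → 1 ≤ m → 1 ≤ n →
    (f : Over.Poly F) → Over.Primitive F q (n * m) f →
    Σ (Fin n → Over.Mat F m) λ C →
    Over.Invertible F (Over.bcm F m n C) ×
    Over.HasOrder F (Over.bcm F m n C) (q ^ (n * m) ∸ 1) ×
    Over._≈ₚ_ F (Over.charPoly F (Over.bcm F m n C)) f
theorem6p1 F q primePower _ (suc m) (suc n) _ _ f f-primitive =
  blocks v , finiteOrder⇒invertible order , order , charPoly≈f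
  where
  open CommutativeRing F using (trans)
  open Over F
  open BlockCompanion F m n
  open CompanionMatrix F
  open CompanionPolynomial F
  open MatrixPower F
  open Reindexing F
  -- One less than the degree: `suc n * suc m` computes to `suc d`.
  d = m ℕ.+ n ℕ.* suc m
  monic = proj₁ f-primitive
  v = coefficients d f monic
  T = bcm (suc m) (suc n) (blocks v)
  order : HasOrder T (q ^ suc d ∸ 1)
  -- `HasOrder` asks for a positive order; this follows from q > 1 and a positive degree.
  order = hasOrder-reindex position (bcm-blocks v) (primitive⇒hasOrder q d f f-primitive
    (ℕ.∸-monoˡ-≤ 1 (1<^ (suc d) (primePower>1 primePower) (s≤s z≤n))))
  charPoly≈f : charPoly T ≈ₚ f
  charPoly≈f k =
    trans (charPoly-cong {A = T} {permutedCompanion v} (bcm-blocks v) k)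
   (trans (charPoly-reindex position (companion v) k)
          (charPoly-companion d f monic k))
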